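{- Given $f\in\mathcal{S}_d^n$ as a black box, one can compute $e_{n,d}(\partial\mathbf{x})f$ (that is, the sum of the coefficients of the multilinear monomials in $f$) using $\binom{n}{\le\lfloor d/2\rfloor}:=\sum_{i=0}^{\lfloor d/2\rfloor}\binom{n}{i}$ queries to $f$.
   Context: $\mathcal{S}_d^n=\mathbb{C}[x_1,\ldots,x_n]_d$ is the space of homogeneous degree-$d$ polynomials in $n$ variables over $\mathbb{C}$. $e_{n,d}=\sum_{1\le i_1<\cdots<i_d\le n}x_{i_1}\cdots x_{i_d}$, and $e_{n,d}(\partial\mathbf{x})$ is the differential operator $e_{n,d}(\partial/\partial x_1,\ldots,\partial/\partial x_n)$. A query to the black box is the choice of a point $v\in\mathbb{C}^n$, answered by $f(v)$. Arithmetic over $\mathbb{C}$ is exact and unit-cost. -}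

module Defs where

open import Algebra.Bundles using (CommutativeRing; CommutativeMonoid; Semiring)
import Algebra.Definitions.RawSemiring as RawSemiringDefinitions
import Algebra.Properties.CommutativeSemigroup as CommutativeSemigroupProperties
import Algebra.Properties.Ring as RingProperties
import Algebra.Solver.Ring.NaturalCoefficients.Default as SemiringSolver
open import Algebra.Structures using (IsCommutativeRing)
open import Data.Bool.Base using (if_then_else_)
open import Data.Fin.Base using (Fin)
open import Data.Fin.Subset using (Subset; inside; outside) renaming (∣_∣ to size)
open import Data.List.Base as List using (List; []; _∷_; _++_)
open import Data.Nat.Base as ℕ using (ℕ; zero; suc)
import Data.Nat.Properties as ℕ
open import Data.Nat.ListAction using (sum)
open import Data.Nat.Combinatorics using (_C_)
open import Data.Nat.GeneralisedArithmetic using (iterate)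
open import Data.Product.Base using (_×_; _,_; ∃-syntax)
open import Data.Rational.Base as ℚ using (ℚ; 0ℚ; 1ℚ; _<_; ∣_∣; positive)
import Data.Rational.Properties as ℚ
open import Data.Vec.Base as Vec using (Vec)
open import Data.Vec.Functional as Vector using (Vector)
open import Data.Vec.Properties using (≡-dec)
open import Level using (0ℓ; _⊔_)
open import Relation.Binary.PropositionalEquality
  using (_≡_; _≢_; refl; sym; trans; cong; cong₂; subst)
open import Relation.Binary.Structures using (IsEquivalence)
open import Relation.Nullary.Decidable.Core using (does)

-- The real numbers, as Cauchy sequences of rationals. The modulus of
-- convergence is part of the data, and equality is equality of limits.

IsCauchy : (ℕ → ℚ) → Set
IsCauchy s = ∀ ε → 0ℚ < ε → ∃[ N ] (∀ m n → N ℕ.≤ m → N ℕ.≤ n → ∣ s m ℚ.- s n ∣ < ε)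

record ℝ : Set where
  constructor mkℝ
  field
    seq    : ℕ → ℚ
    cauchy : IsCauchy seq

open ℝ public

infix 4 _≈ℝ_

-- A record rather than a function, so that x and y can be inferred from
-- the type x ≈ℝ y.
record _≈ℝ_ (x y : ℝ) : Set where
  constructor mk≈ℝ
  field
    close : ∀ ε → 0ℚ < ε → ∃[ N ] (∀ n → N ℕ.≤ n → ∣ seq x n ℚ.- seq y n ∣ < ε)

open _≈ℝ_ public

private
  +-interchange : ∀ p q r s → (p ℚ.+ q) ℚ.+ (r ℚ.+ s) ≡ (p ℚ.+ r) ℚ.+ (q ℚ.+ s)
  +-interchange = CommutativeSemigroupProperties.interchange
    (CommutativeMonoid.commutativeSemigroup ℚ.+-0-commutativeMonoid)

  cancel : ∀ p q → (p ℚ.- q) ℚ.+ q ≡ p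
  cancel p q = trans (ℚ.+-assoc p (ℚ.- q) q)
    (trans (cong (p ℚ.+_) (ℚ.+-inverseˡ q)) (ℚ.+-identityʳ p))

  telescope : ∀ p q r → p ℚ.- r ≡ (p ℚ.- q) ℚ.+ (q ℚ.- r)
  telescope p q r = trans (cong (ℚ._- r) (sym (cancel p q)))
    (ℚ.+-assoc (p ℚ.- q) q (ℚ.- r))

  add-identity : ∀ p q r s → (p ℚ.+ q) ℚ.- (r ℚ.+ s) ≡ (p ℚ.- r) ℚ.+ (q ℚ.- s)
  add-identity p q r s = trans (cong ((p ℚ.+ q) ℚ.+_) (ℚ.neg-distrib-+ r s))
    (+-interchange p q (ℚ.- r) (ℚ.- s))

  *-distribʳ-- : ∀ p r q → (p ℚ.- r) ℚ.* q ≡ p ℚ.* q ℚ.- r ℚ.* q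
  *-distribʳ-- p r q = trans (ℚ.*-distribʳ-+ q p (ℚ.- r))
    (cong (p ℚ.* q ℚ.+_) (sym (ℚ.neg-distribˡ-* r q)))

  mul-identity : ∀ p q r s →
    (p ℚ.* q) ℚ.- (r ℚ.* s) ≡ (p ℚ.- r) ℚ.* q ℚ.+ (q ℚ.- s) ℚ.* r
  mul-identity p q r s = trans (telescope (p ℚ.* q) (r ℚ.* q) (r ℚ.* s))
    (cong₂ ℚ._+_ (sym (*-distribʳ-- p r q))
      (trans (cong₂ ℚ._-_ (ℚ.*-comm r q) (ℚ.*-comm r s)) (sym (*-distribʳ-- q s r))))

  neg-identity : ∀ p q → (ℚ.- p) ℚ.- (ℚ.- q) ≡ q ℚ.- p
  neg-identity p q = trans (ℚ.+-comm (ℚ.- p) (ℚ.- (ℚ.- q)))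
    (cong (ℚ._- p) (RingProperties.-‿involutive ℚ.+-*-ring q))

  half : ∀ ε → 0ℚ < ε → ∃[ δ ] (0ℚ < δ × δ ℚ.+ δ ≡ ε)
  half ε 0<ε = δ , 0<δ , eq
    where
    δ = ε ℚ.* ℚ.½
    0<δ = subst (_< δ) (ℚ.*-zeroˡ ℚ.½) (ℚ.*-monoˡ-<-pos ℚ.½ 0<ε)
    eq : δ ℚ.+ δ ≡ ε
    eq = trans (sym (ℚ.*-distribˡ-+ ε ℚ.½ ℚ.½)) (ℚ.*-identityʳ ε)

  divide : ∀ ε b → 0ℚ < ε → 0ℚ < b → ∃[ δ ] (0ℚ < δ × δ ℚ.* b ≡ ε)
  divide ε b 0<ε 0<b = ε ℚ.* b⁻¹ , 0<δ , eq
    where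
    instance
      pb = positive 0<b
      nb = ℚ.pos⇒nonZero b
    b⁻¹ = ℚ.1/ b
    instance
      pb⁻¹ = ℚ.1/pos⇒pos b
    0<δ = subst (_< ε ℚ.* b⁻¹) (ℚ.*-zeroˡ b⁻¹) (ℚ.*-monoˡ-<-pos b⁻¹ 0<ε)
    eq : ε ℚ.* b⁻¹ ℚ.* b ≡ ε
    eq = trans (ℚ.*-assoc ε b⁻¹ b) (trans (cong (ε ℚ.*_) (ℚ.*-inverseˡ b)) (ℚ.*-identityʳ ε))

  sum-bound : ∀ {p q r δ ε} → r ≡ p ℚ.+ q → δ ℚ.+ δ ≡ ε →
              ∣ p ∣ < δ → ∣ q ∣ < δ → ∣ r ∣ < ε
  sum-bound {p} {q} refl refl a b = ℚ.≤-<-trans (ℚ.∣p+q∣≤∣p∣+∣q∣ p q) (ℚ.+-mono-< a b)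

  product-bound : ∀ {p q δ b ε} → 0ℚ < b → δ ℚ.* b ≡ ε →
                  ∣ p ∣ < δ → ∣ q ∣ < b → ∣ p ℚ.* q ∣ < ε
  product-bound {p} {q} {δ} {b} 0<b refl a c =
    subst (_< δ ℚ.* b) (sym (ℚ.∣p*q∣≡∣p∣*∣q∣ p q))
      (ℚ.≤-<-trans
        (ℚ.*-monoˡ-≤-nonNeg ∣ p ∣ {{ℚ.nonNegative (ℚ.0≤∣p∣ p)}} (ℚ.<⇒≤ c))
        (ℚ.*-monoˡ-<-pos b {{positive 0<b}} a))

  abs-minus-sym : ∀ p q → ∣ p ℚ.- q ∣ ≡ ∣ q ℚ.- p ∣
  abs-minus-sym p q = trans (sym (ℚ.∣-p∣≡∣p∣ (p ℚ.- q)))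
    (cong ∣_∣ (trans (ℚ.neg-distrib-+ p (ℚ.- q)) (neg-identity p q)))

  ⊔ˡ : ∀ M N {n} → M ℕ.⊔ N ℕ.≤ n → M ℕ.≤ n
  ⊔ˡ M N = ℕ.≤-trans (ℕ.m≤m⊔n M N)

  ⊔ʳ : ∀ M N {n} → M ℕ.⊔ N ℕ.≤ n → N ℕ.≤ n
  ⊔ʳ M N = ℕ.≤-trans (ℕ.m≤n⊔m M N)

  0<1 : 0ℚ < 1ℚ
  0<1 = ℚ.positive⁻¹ 1ℚ

  bounded : ∀ s → IsCauchy s → ∃[ b ] (0ℚ < b × ∃[ N ] (∀ n → N ℕ.≤ n → ∣ s n ∣ < b))
  bounded s cs with cs 1ℚ 0<1
  ... | N , h = b , 0<b , N , bound
    where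
    b = 1ℚ ℚ.+ ∣ s N ∣
    0<b : 0ℚ < b
    0<b = ℚ.<-≤-trans 0<1
      (subst (ℚ._≤ b) (ℚ.+-identityʳ 1ℚ) (ℚ.+-monoʳ-≤ 1ℚ (ℚ.0≤∣p∣ (s N))))
    bound : ∀ n → N ℕ.≤ n → ∣ s n ∣ < b
    bound n N≤n = ℚ.≤-<-trans
      (subst (λ t → ∣ t ∣ ℚ.≤ ∣ s n ℚ.- s N ∣ ℚ.+ ∣ s N ∣)
        (cancel (s n) (s N))
        (ℚ.∣p+q∣≤∣p∣+∣q∣ (s n ℚ.- s N) (s N)))
      (ℚ.+-monoˡ-< ∣ s N ∣ (h n N N≤n ℕ.≤-refl))

  common-bound : ∀ s t → IsCauchy s → IsCauchy t →
    ∃[ b ] (0ℚ < b × ∃[ N ] ((∀ n → N ℕ.≤ n → ∣ s n ∣ < b) × (∀ n → N ℕ.≤ n → ∣ t n ∣ < b)))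
  common-bound s t cs ct =
    let b , 0<b , M , h = bounded s cs
        c , 0<c , N , k = bounded t ct
    in b ℚ.+ c , ℚ.+-mono-< 0<b 0<c , M ℕ.⊔ N ,
      (λ n l → ℚ.<-trans (h n (⊔ˡ M N l)) (subst (_< b ℚ.+ c) (ℚ.+-identityʳ b) (ℚ.+-monoʳ-< b 0<c))) ,
      (λ n l → ℚ.<-trans (k n (⊔ʳ M N l)) (subst (_< b ℚ.+ c) (ℚ.+-identityˡ c) (ℚ.+-monoˡ-< c 0<b)))

  ∣p-p∣<ε : ∀ p {ε} → 0ℚ < ε → ∣ p ℚ.- p ∣ < ε
  ∣p-p∣<ε p {ε} = subst (_< ε) (sym (cong ∣_∣ (ℚ.+-inverseʳ p)))

  neg-close : ∀ {ε} p q → ∣ p ℚ.- q ∣ < ε → ∣ (ℚ.- p) ℚ.- (ℚ.- q) ∣ < ε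
  neg-close {ε} p q =
    subst (_< ε) (trans (abs-minus-sym p q) (cong ∣_∣ (sym (neg-identity p q))))

  const-cauchy : ∀ q → IsCauchy (λ _ → q)
  const-cauchy q ε 0<ε = 0 , λ _ _ _ _ → ∣p-p∣<ε q 0<ε

  -- Abstract, so that comparing real numbers does not unfold the proofs.
  abstract
    +-cauchy : ∀ s t → IsCauchy s → IsCauchy t → IsCauchy (λ n → s n ℚ.+ t n)
    +-cauchy s t cs ct ε 0<ε =
      let δ , 0<δ , e = half ε 0<ε
          M , h = cs δ 0<δ
          N , k = ct δ 0<δ
      in M ℕ.⊔ N , λ m n l r →
        sum-bound (add-identity (s m) (t m) (s n) (t n)) e
          (h m n (⊔ˡ M N l) (⊔ˡ M N r)) (k m n (⊔ʳ M N l) (⊔ʳ M N r))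

    *-cauchy : ∀ s t → IsCauchy s → IsCauchy t → IsCauchy (λ n → s n ℚ.* t n)
    *-cauchy s t cs ct ε 0<ε =
      let b , 0<b , B , hs , ht = common-bound s t cs ct
          η , 0<η , e = half ε 0<ε
          δ , 0<δ , e′ = divide η b 0<η 0<b
          M , h = cs δ 0<δ
          N , k = ct δ 0<δ
          K = M ℕ.⊔ N
      in K ℕ.⊔ B , λ m n l r →
        sum-bound (mul-identity (s m) (t m) (s n) (t n)) e
          (product-bound 0<b e′
            (h m n (⊔ˡ M N (⊔ˡ K B l)) (⊔ˡ M N (⊔ˡ K B r))) (ht m (⊔ʳ K B l)))
          (product-bound 0<b e′
            (k m n (⊔ʳ M N (⊔ˡ K B l)) (⊔ʳ M N (⊔ˡ K B r))) (hs n (⊔ʳ K B r)))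

    neg-cauchy : ∀ s → IsCauchy s → IsCauchy (λ n → ℚ.- s n)
    neg-cauchy s cs ε 0<ε = let N , h = cs ε 0<ε in
      N , λ m n l r → neg-close (s m) (s n) (h m n l r)

infixl 6 _+ℝ_
infixl 7 _*ℝ_
infix  8 -ℝ_

_+ℝ_ _*ℝ_ : ℝ → ℝ → ℝ
x +ℝ y = mkℝ (λ n → seq x n ℚ.+ seq y n) (+-cauchy (seq x) (seq y) (cauchy x) (cauchy y))
x *ℝ y = mkℝ (λ n → seq x n ℚ.* seq y n) (*-cauchy (seq x) (seq y) (cauchy x) (cauchy y))

-ℝ_ : ℝ → ℝ
-ℝ x = mkℝ (λ n → ℚ.- seq x n) (neg-cauchy (seq x) (cauchy x))

fromℚ : ℚ → ℝ
fromℚ q = mkℝ (λ _ → q) (const-cauchy q)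

pointwise : ∀ {x y} → (∀ n → seq x n ≡ seq y n) → x ≈ℝ y
pointwise {x} {y} h = mk≈ℝ λ ε 0<ε → 0 , λ n _ →
  subst (λ t → ∣ seq x n ℚ.- t ∣ < ε) (h n) (∣p-p∣<ε (seq x n) 0<ε)

≈ℝ-refl : ∀ {x} → x ≈ℝ x
≈ℝ-refl = pointwise (λ _ → refl)

≈ℝ-sym : ∀ {x y} → x ≈ℝ y → y ≈ℝ x
≈ℝ-sym {x} {y} x≈y = mk≈ℝ λ ε 0<ε → let N , h = close x≈y ε 0<ε in
  N , λ n l → subst (_< ε) (abs-minus-sym (seq x n) (seq y n)) (h n l)

≈ℝ-trans : ∀ {x y z} → x ≈ℝ y → y ≈ℝ z → x ≈ℝ z
≈ℝ-trans {x} {y} {z} x≈y y≈z = mk≈ℝ λ ε 0<ε →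
  let δ , 0<δ , e = half ε 0<ε
      M , h = close x≈y δ 0<δ
      N , k = close y≈z δ 0<δ
  in M ℕ.⊔ N , λ n l →
    sum-bound (telescope (seq x n) (seq y n) (seq z n)) e (h n (⊔ˡ M N l)) (k n (⊔ʳ M N l))

+ℝ-cong : ∀ {x x′ y y′} → x ≈ℝ x′ → y ≈ℝ y′ → x +ℝ y ≈ℝ x′ +ℝ y′
+ℝ-cong {x} {x′} {y} {y′} x≈x′ y≈y′ = mk≈ℝ λ ε 0<ε →
  let δ , 0<δ , e = half ε 0<ε
      M , h = close x≈x′ δ 0<δ
      N , k = close y≈y′ δ 0<δ
  in M ℕ.⊔ N , λ n l →
    sum-bound (add-identity (seq x n) (seq y n) (seq x′ n) (seq y′ n)) e
      (h n (⊔ˡ M N l)) (k n (⊔ʳ M N l))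

*ℝ-cong : ∀ {x x′ y y′} → x ≈ℝ x′ → y ≈ℝ y′ → x *ℝ y ≈ℝ x′ *ℝ y′
*ℝ-cong {x} {x′} {y} {y′} x≈x′ y≈y′ = mk≈ℝ λ ε 0<ε →
  let b , 0<b , B , hy , hx′ = common-bound (seq y) (seq x′) (cauchy y) (cauchy x′)
      η , 0<η , e = half ε 0<ε
      δ , 0<δ , e′ = divide η b 0<η 0<b
      M , h = close x≈x′ δ 0<δ
      N , k = close y≈y′ δ 0<δ
  in (M ℕ.⊔ N) ℕ.⊔ B , λ n l →
    sum-bound (mul-identity (seq x n) (seq y n) (seq x′ n) (seq y′ n)) e
      (product-bound 0<b e′ (h n (⊔ˡ M N (⊔ˡ (M ℕ.⊔ N) B l))) (hy n (⊔ʳ (M ℕ.⊔ N) B l)))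
      (product-bound 0<b e′ (k n (⊔ʳ M N (⊔ˡ (M ℕ.⊔ N) B l))) (hx′ n (⊔ʳ (M ℕ.⊔ N) B l)))

-ℝ-cong : ∀ {x y} → x ≈ℝ y → -ℝ x ≈ℝ -ℝ y
-ℝ-cong {x} {y} x≈y = mk≈ℝ λ ε 0<ε → let N , h = close x≈y ε 0<ε in
  N , λ n l → neg-close (seq x n) (seq y n) (h n l)

≈ℝ-isEquivalence : IsEquivalence _≈ℝ_
≈ℝ-isEquivalence = record { refl = ≈ℝ-refl ; sym = ≈ℝ-sym ; trans = ≈ℝ-trans }

ℝ-isCommutativeRing : IsCommutativeRing _≈ℝ_ _+ℝ_ _*ℝ_ -ℝ_ (fromℚ 0ℚ) (fromℚ 1ℚ)
ℝ-isCommutativeRing = record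
  { isRing = record
    { +-isAbelianGroup = record
      { isGroup = record
        { isMonoid = record
          { isSemigroup = record
            { isMagma = record { isEquivalence = ≈ℝ-isEquivalence ; ∙-cong = +ℝ-cong }
            ; assoc = λ x y z → pointwise λ n → ℚ.+-assoc (seq x n) (seq y n) (seq z n)
            }
          ; identity = (λ x → pointwise λ n → ℚ.+-identityˡ (seq x n))
                     , (λ x → pointwise λ n → ℚ.+-identityʳ (seq x n))
          }
        ; inverse = (λ x → pointwise λ n → ℚ.+-inverseˡ (seq x n))
                  , (λ x → pointwise λ n → ℚ.+-inverseʳ (seq x n))
        ; ⁻¹-cong = -ℝ-cong
        }
      ; comm = λ x y → pointwise λ n → ℚ.+-comm (seq x n) (seq y n)
      }
    ; *-cong = *ℝ-cong
    ; *-assoc = λ x y z → pointwise λ n → ℚ.*-assoc (seq x n) (seq y n) (seq z n)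
    ; *-identity = (λ x → pointwise λ n → ℚ.*-identityˡ (seq x n))
                 , (λ x → pointwise λ n → ℚ.*-identityʳ (seq x n))
    ; distrib = (λ x y z → pointwise λ n → ℚ.*-distribˡ-+ (seq x n) (seq y n) (seq z n))
              , (λ x y z → pointwise λ n → ℚ.*-distribʳ-+ (seq x n) (seq y n) (seq z n))
    }
  ; *-comm = λ x y → pointwise λ n → ℚ.*-comm (seq x n) (seq y n)
  }

ℝ-commutativeRing : CommutativeRing 0ℓ 0ℓ
ℝ-commutativeRing = record { isCommutativeRing = ℝ-isCommutativeRing }

infix 5 _+i_

record ℂ : Set where
  constructor _+i_
  field
    re im : ℝ

open ℂ public

infix 4 _≈ℂ_

record _≈ℂ_ (z w : ℂ) : Set where
  constructor mk≈ℂ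
  field
    re≈ : re z ≈ℝ re w
    im≈ : im z ≈ℝ im w

open _≈ℂ_ public

infixl 6 _+ℂ_
infixl 7 _*ℂ_
infix  8 -ℂ_

_+ℂ_ _*ℂ_ : ℂ → ℂ → ℂ
(a +i b) +ℂ (c +i d) = (a +ℝ c) +i (b +ℝ d)
(a +i b) *ℂ (c +i d) = (a *ℝ c +ℝ -ℝ (b *ℝ d)) +i (a *ℝ d +ℝ b *ℝ c)

-ℂ_ : ℂ → ℂ
-ℂ (a +i b) = (-ℝ a) +i (-ℝ b)

0ℂ 1ℂ : ℂ
0ℂ = fromℚ 0ℚ +i fromℚ 0ℚ
1ℂ = fromℚ 1ℚ +i fromℚ 0ℚ

≈ℂ-isEquivalence : IsEquivalence _≈ℂ_
≈ℂ-isEquivalence = record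
  { refl  = mk≈ℂ ≈ℝ-refl ≈ℝ-refl
  ; sym   = λ (mk≈ℂ a b) → mk≈ℂ (≈ℝ-sym a) (≈ℝ-sym b)
  ; trans = λ (mk≈ℂ a b) (mk≈ℂ c d) → mk≈ℂ (≈ℝ-trans a c) (≈ℝ-trans b d)
  }

private
  -- The real and imaginary parts of the ring laws of R[√-1], proved as
  -- semiring identities that hold with any m in place of -1.
  module QuadraticLaws {c ℓ} (R : CommutativeRing c ℓ) where
    open CommutativeRing R renaming (refl to ≈-refl; sym to ≈-sym; trans to ≈-trans)
    open SemiringSolver commutativeSemiring
    open RingProperties ring using (-1*x≈-x)

    minus : ∀ x → - x ≈ (- 1#) * x
    minus x = ≈-sym (-1*x≈-x x)

    mul-re : ∀ a b c d → a * c + - (b * d) ≈ a * c + (- 1#) * (b * d)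
    mul-re a b c d = +-congˡ (minus (b * d))

    re-comm : ∀ a b c d → a * c + - (b * d) ≈ c * a + - (d * b)
    re-comm a b c d = +-cong (*-comm a c) (-‿cong (*-comm b d))

    im-comm : ∀ a b c d → a * d + b * c ≈ c * b + d * a
    im-comm = solve 4 (λ a b c d → a :* d :+ b :* c := c :* b :+ d :* a) ≈-refl

    re-assoc : ∀ a b c d e f →
      (a * c + - (b * d)) * e + - ((a * d + b * c) * f) ≈
      a * (c * e + - (d * f)) + - (b * (c * f + d * e))
    re-assoc a b c d e f =
      ≈-trans (+-cong (*-congʳ (mul-re a b c d)) (minus _))
        (≈-trans (generic (- 1#) a b c d e f)
          (≈-sym (+-cong (*-congˡ (mul-re c d e f)) (minus _))))
      where
      generic = solve 7 (λ m a b c d e f →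
        (a :* c :+ m :* (b :* d)) :* e :+ m :* ((a :* d :+ b :* c) :* f) :=
        a :* (c :* e :+ m :* (d :* f)) :+ m :* (b :* (c :* f :+ d :* e))) ≈-refl

    im-assoc : ∀ a b c d e f →
      (a * c + - (b * d)) * f + (a * d + b * c) * e ≈
      a * (c * f + d * e) + b * (c * e + - (d * f))
    im-assoc a b c d e f =
      ≈-trans (+-congʳ (*-congʳ (mul-re a b c d)))
        (≈-trans (generic (- 1#) a b c d e f) (≈-sym (+-congˡ (*-congˡ (mul-re c d e f)))))
      where
      generic = solve 7 (λ m a b c d e f →
        (a :* c :+ m :* (b :* d)) :* f :+ (a :* d :+ b :* c) :* e :=
        a :* (c :* f :+ d :* e) :+ b :* (c :* e :+ m :* (d :* f))) ≈-refl

    re-identity : ∀ a b → 1# * a + - (0# * b) ≈ a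
    re-identity a b = ≈-trans (mul-re 1# 0# a b) (generic (- 1#) a b)
      where
      generic = solve 3 (λ m a b → con 1 :* a :+ m :* (con 0 :* b) := a) ≈-refl

    im-identity : ∀ a b → 1# * b + 0# * a ≈ b
    im-identity = solve 2 (λ a b → con 1 :* b :+ con 0 :* a := b) ≈-refl

    re-distrib : ∀ a b c d e f →
      (a + c) * e + - ((b + d) * f) ≈ (a * e + - (b * f)) + (c * e + - (d * f))
    re-distrib a b c d e f = ≈-trans (mul-re _ _ e f)
      (≈-trans (generic (- 1#) a b c d e f) (≈-sym (+-cong (mul-re a b e f) (mul-re c d e f))))
      where
      generic = solve 7 (λ m a b c d e f →
        (a :+ c) :* e :+ m :* ((b :+ d) :* f) :=
        (a :* e :+ m :* (b :* f)) :+ (c :* e :+ m :* (d :* f))) ≈-refl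

    im-distrib : ∀ a b c d e f →
      (a + c) * f + (b + d) * e ≈ (a * f + b * e) + (c * f + d * e)
    im-distrib = solve 6 (λ a b c d e f →
      (a :+ c) :* f :+ (b :+ d) :* e := (a :* f :+ b :* e) :+ (c :* f :+ d :* e)) ≈-refl

  module L = QuadraticLaws ℝ-commutativeRing
  module ℝR = CommutativeRing ℝ-commutativeRing
  module ≈ℂ = IsEquivalence ≈ℂ-isEquivalence

  +ℂ-cong : ∀ {z z′ w w′} → z ≈ℂ z′ → w ≈ℂ w′ → z +ℂ w ≈ℂ z′ +ℂ w′
  +ℂ-cong (mk≈ℂ a b) (mk≈ℂ c d) = mk≈ℂ (+ℝ-cong a c) (+ℝ-cong b d)

  *ℂ-cong : ∀ {z z′ w w′} → z ≈ℂ z′ → w ≈ℂ w′ → z *ℂ w ≈ℂ z′ *ℂ w′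
  *ℂ-cong (mk≈ℂ a b) (mk≈ℂ c d) = mk≈ℂ
    (+ℝ-cong (*ℝ-cong a c) (-ℝ-cong (*ℝ-cong b d)))
    (+ℝ-cong (*ℝ-cong a d) (*ℝ-cong b c))

  *ℂ-comm : ∀ z w → z *ℂ w ≈ℂ w *ℂ z
  *ℂ-comm (a +i b) (c +i d) = mk≈ℂ (L.re-comm a b c d) (L.im-comm a b c d)

  *ℂ-assoc : ∀ z w u → (z *ℂ w) *ℂ u ≈ℂ z *ℂ (w *ℂ u)
  *ℂ-assoc (a +i b) (c +i d) (e +i f) =
    mk≈ℂ (L.re-assoc a b c d e f) (L.im-assoc a b c d e f)

  *ℂ-identityˡ : ∀ z → 1ℂ *ℂ z ≈ℂ z
  *ℂ-identityˡ (a +i b) = mk≈ℂ (L.re-identity a b) (L.im-identity a b)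

  *ℂ-distribʳ : ∀ u z w → (z +ℂ w) *ℂ u ≈ℂ z *ℂ u +ℂ w *ℂ u
  *ℂ-distribʳ (e +i f) (a +i b) (c +i d) =
    mk≈ℂ (L.re-distrib a b c d e f) (L.im-distrib a b c d e f)

ℂ-isCommutativeRing : IsCommutativeRing _≈ℂ_ _+ℂ_ _*ℂ_ -ℂ_ 0ℂ 1ℂ
ℂ-isCommutativeRing = record
  { isRing = record
    { +-isAbelianGroup = record
      { isGroup = record
        { isMonoid = record
          { isSemigroup = record
            { isMagma = record { isEquivalence = ≈ℂ-isEquivalence ; ∙-cong = +ℂ-cong }
            ; assoc = λ (a +i b) (c +i d) (e +i f) → mk≈ℂ (ℝR.+-assoc a c e) (ℝR.+-assoc b d f)
            }
          ; identity = (λ (a +i b) → mk≈ℂ (ℝR.+-identityˡ a) (ℝR.+-identityˡ b))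
                     , (λ (a +i b) → mk≈ℂ (ℝR.+-identityʳ a) (ℝR.+-identityʳ b))
          }
        ; inverse = (λ (a +i b) → mk≈ℂ (ℝR.-‿inverseˡ a) (ℝR.-‿inverseˡ b))
                  , (λ (a +i b) → mk≈ℂ (ℝR.-‿inverseʳ a) (ℝR.-‿inverseʳ b))
        ; ⁻¹-cong = λ (mk≈ℂ a b) → mk≈ℂ (-ℝ-cong a) (-ℝ-cong b)
        }
      ; comm = λ (a +i b) (c +i d) → mk≈ℂ (ℝR.+-comm a c) (ℝR.+-comm b d)
      }
    ; *-cong = *ℂ-cong
    ; *-assoc = *ℂ-assoc
    ; *-identity = *ℂ-identityˡ , λ z → ≈ℂ.trans (*ℂ-comm z 1ℂ) (*ℂ-identityˡ z)
    ; distrib = (λ u z w → ≈ℂ.trans (*ℂ-comm u (z +ℂ w))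
                  (≈ℂ.trans (*ℂ-distribʳ u z w) (+ℂ-cong (*ℂ-comm z u) (*ℂ-comm w u))))
              , *ℂ-distribʳ
    }
  ; *-comm = *ℂ-comm
  }

ℂ-commutativeRing : CommutativeRing 0ℓ 0ℓ
ℂ-commutativeRing = record { isCommutativeRing = ℂ-isCommutativeRing }

subsets : ∀ n → List (Subset n)
subsets zero    = Vec.[] ∷ []
subsets (suc n) = List.map (outside Vec.∷_) (subsets n) ++ List.map (inside Vec.∷_) (subsets n)

binomialSum : ℕ → ℕ → ℕ
binomialSum n k = sum (List.map (n C_) (List.upTo (suc k)))

module Polynomials {c ℓ} (R : CommutativeRing c ℓ) where

  open CommutativeRing R hiding (refl; sym; trans)
  open RawSemiringDefinitions (Semiring.rawSemiring semiring)
    using (_^_; product) renaming (_×_ to _·_)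

  -- The exponent vector (α₁ , … , αₙ) of x₁^α₁ ⋯ xₙ^αₙ.
  Exponent : ℕ → Set
  Exponent n = Vec ℕ n

  -- Formal sums of terms. An exponent may occur in several terms, so two
  -- sums are the same polynomial when all coefficients agree (_≈ₚ_).
  Polynomial : ℕ → Set c
  Polynomial n = List (Carrier × Exponent n)

  coeff : ∀ {n} → Polynomial n → Exponent n → Carrier
  coeff []             α = 0#
  coeff ((a , β) ∷ f) α = if does (≡-dec ℕ._≟_ β α) then a + coeff f α else coeff f α

  infix 4 _≈ₚ_

  _≈ₚ_ : ∀ {n} → Polynomial n → Polynomial n → Set ℓ
  f ≈ₚ g = ∀ α → coeff f α ≈ coeff g α

  Homogeneous : ∀ {n} → ℕ → Polynomial n → Set ℓ
  Homogeneous d f = ∀ α → Vec.sum α ≢ d → coeff f α ≈ 0#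

  constant : ∀ {n} → Carrier → Polynomial n
  constant {n} a = (a , Vec.replicate n 0) ∷ []

  eval : ∀ {n} → Polynomial n → Vector Carrier n → Carrier
  eval []             v = 0#
  eval ((a , α) ∷ f) v = a * product (λ i → v i ^ Vec.lookup α i) + eval f v

  -- When the i-th exponent is 0 the coefficient becomes 0, so truncated
  -- predecessor is harmless.
  ∂ : ∀ {n} → Fin n → Polynomial n → Polynomial n
  ∂ i = List.map λ (a , α) → (Vec.lookup α i · a) , Vec.updateAt α i ℕ.pred

  ∂^ : ∀ {n} → Exponent n → Polynomial n → Polynomial n
  ∂^ {n} β f = List.foldr (λ i h → iterate (∂ i) h (Vec.lookup β i)) f (List.allFin n)

  -- g ⟨∂𝐱⟩ f is g(∂/∂x₁ , … , ∂/∂xₙ) applied to f.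
  infixr 8 _⟨∂𝐱⟩_

  _⟨∂𝐱⟩_ : ∀ {n} → Polynomial n → Polynomial n → Polynomial n
  g ⟨∂𝐱⟩ f = List.concatMap (λ (b , β) → List.map (λ (a , α) → (b * a) , α) (∂^ β f)) g

  -- The exponent of ∏_{i ∈ S} xᵢ; these are the multilinear monomials.
  indicator : ∀ {n} → Subset n → Exponent n
  indicator = Vec.map (λ s → if s then 1 else 0)

  elementary : ∀ n → ℕ → Polynomial n
  elementary n d =
    List.map (λ S → 1# , indicator S) (List.filter (λ S → size S ℕ.≟ d) (subsets n))

  multilinearSum : ∀ {n} → Polynomial n → Carrier
  multilinearSum {n} f = List.foldr (λ S s → coeff f (indicator S) + s) 0# (subsets n)

  -- Algebraic programs with access to a black box for a function of n
  -- variables, starting from k filled registers. Each instruction puts its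
  -- result in a new register, numbered 0, and shifts the numbers of the
  -- others. A queried point is made of computed values, so it may depend on
  -- earlier answers. Division and branching are not needed, and leaving
  -- them out only makes the existence of a program a stronger claim.
  data Program (n : ℕ) (k : ℕ) : Set c where
    output  : Fin k → Program n k
    literal : Carrier → Program n (suc k) → Program n k
    add     : Fin k → Fin k → Program n (suc k) → Program n k
    mul     : Fin k → Fin k → Program n (suc k) → Program n k
    neg     : Fin k → Program n (suc k) → Program n k
    query   : Vector (Fin k) n → Program n (suc k) → Program n k

  exec : ∀ {n k} → Program n k → (Vector Carrier n → Carrier) → Vector Carrier k → Carrier
  exec (output i)    F r = r i
  exec (literal a p) F r = exec p F (a Vector.∷ r)
  exec (add i j p)   F r = exec p F ((r i + r j) Vector.∷ r)
  exec (mul i j p)   F r = exec p F ((r i * r j) Vector.∷ r)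
  exec (neg i p)     F r = exec p F ((- r i) Vector.∷ r)
  exec (query v p)   F r = exec p F (F (λ i → r (v i)) Vector.∷ r)

  run : ∀ {n} → Program n 0 → (Vector Carrier n → Carrier) → Carrier
  run p F = exec p F Vector.[]

  queries : ∀ {n k} → Program n k → ℕ
  queries (output _)    = 0
  queries (literal _ p) = queries p
  queries (add _ _ p)   = queries p
  queries (mul _ _ p)   = queries p
  queries (neg _ p)     = queries p
  queries (query _ p)   = suc (queries p)

open Polynomials ℂ-commutativeRing public

{-# OPTIONS --safe #-}

-- At a point with coordinates ±1, the monomial x^α depends only on the
-- parities of the exponents. For every polynomial p of degree at most k
-- there are weights on the sign vectors with at most k entries -1 such that
-- the weighted sum of the values of x^α is p(m), where m is the number of
-- odd exponents of x^α. If x^α has degree d then d - m = 2e with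
-- 0 ≤ e ≤ ⌊d/2⌋, and e = 0 exactly when x^α is multilinear. So with
-- k = ⌊d/2⌋ and p(m) = ∏_{1 ≤ j ≤ k} (m + 2j - d) / 2j the weighted sum of
-- the values of f is the sum of its multilinear coefficients.

module Submission where

open import Algebra.Bundles using (CommutativeRing; Semiring)
import Algebra.Definitions.RawSemiring as RawSemiringDefinitions
import Algebra.Properties.Ring as RingProperties
import Algebra.Properties.Semiring.Mult as SemiringMultProperties
import Algebra.Properties.Semiring.Exp as SemiringExpProperties
import Algebra.Solver.Ring.NaturalCoefficients.Default as SemiringSolver
open import Data.Bool.Base using (Bool; true; false; if_then_else_)
open import Data.Fin.Base using (Fin; zero; suc)
import Data.Fin.Properties as Fin
open import Data.Fin.Subset using (Subset; inside; outside) renaming (∣_∣ to size)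
open import Data.List.Base as List using (List; []; _∷_; _++_; length; deduplicate; applyUpTo)
open import Data.List.Membership.Propositional using (_∈_; _∉_)
open import Data.List.Membership.Propositional.Properties using (∈-deduplicate⁺; ∈-map⁺; ∈-allFin)
open import Data.List.Properties using (map-id; map-∘; length-++; length-map; map-applyUpTo)
open import Data.List.Relation.Unary.All as All using (All; []; _∷_)
open import Data.List.Relation.Unary.Any using (here; there)
open import Data.List.Relation.Unary.Unique.Propositional using (Unique; []; _∷_)
open import Data.List.Relation.Unary.Unique.Propositional.Properties using (allFin⁺)
open import Data.List.Relation.Unary.All.Properties using (All¬⇒¬Any)
open import Data.Nat.Base as ℕ using (ℕ; zero; suc; pred; ⌊_/2⌋; z≤n; s≤s)
import Data.Nat.Properties as ℕ
open import Data.Nat.GeneralisedArithmetic using (iterate)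
open import Data.Nat.ListAction using (sum)
open import Data.Nat.Combinatorics using (_C_; nCk+nC[k+1]≡[n+1]C[k+1])
open import Data.Product.Base using (_×_; _,_; proj₁; proj₂; Σ-syntax; ∃-syntax)
open import Data.Rational.Base as ℚ using (ℚ; 0ℚ; 1ℚ)
import Data.Rational.Properties as ℚ
open import Data.Sum.Base using (_⊎_; inj₁; inj₂)
open import Data.Vec.Base as Vec using (Vec; []; _∷_; lookup; updateAt; replicate)
open import Data.Vec.Functional as Vector using (Vector)
open import Data.Vec.Properties 
  using (≡-dec; lookup-map; lookup∘updateAt; lookup∘updateAt′; ∷-injectiveˡ; ∷-injectiveʳ)
open import Data.Nat.Solver using () renaming (module +-*-Solver to ℕSolver)
open import Function.Base using (_∘_; id)
open import Relation.Binary.PropositionalEquality as ≡ using (_≡_; _≢_; cong; cong₂; subst)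
open import Relation.Nullary using (¬_; Dec; does; yes; no; contradiction)
open import Relation.Unary using (Pred; Decidable)

open import Defs using (module Polynomials; subsets; binomialSum)

-- A weighted sum of values of f, a coefficient of f and a coefficient of a derivative of f are all
-- linear functionals, fixed by their values on monomials. So each identity reduces to one about a
-- single exponent of degree d. The obstacle is that f is a formal sum: terms of other degrees may
-- be present and cancel. `Homogeneous` speaks of coefficients only, so functionals must be
-- rewritten in terms of coefficients before it applies. The weights come from induction on n.
-- Putting +1 or -1 in the first coordinate yields A + (-1)^a B, with a the first exponent; here A
-- is the mean of p m and p (m + 1), and B is half of p m - p (m + 1). The degree bound of B is one
-- less than that of p, which pays for the one entry -1 taken from the budget, and A keeps the bound
-- of p. If the budget is 0, p is constant and B vanishes. The same recursion counts the points, by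
-- Pascal's rule.

-- Finite sums over lists.

module ListSums {c ℓ} (R : CommutativeRing c ℓ) where

  open CommutativeRing R hiding (zero)
  open SemiringSolver commutativeSemiring
  open import Relation.Binary.Reasoning.Setoid setoid

  ∑ : ∀ {a} {A : Set a} → (A → Carrier) → List A → Carrier
  ∑ g = List.foldr (λ x s → g x + s) 0#

  module _ {a} {A : Set a} where

    ∑-cong : ∀ {g h : A → Carrier} → (∀ x → g x ≈ h x) → ∀ xs → ∑ g xs ≈ ∑ h xs
    ∑-cong g≈h []       = refl
    ∑-cong g≈h (x ∷ xs) = +-cong (g≈h x) (∑-cong g≈h xs)

    ∑-zero : ∀ {g : A → Carrier} → (∀ x → g x ≈ 0#) → ∀ xs → ∑ g xs ≈ 0#
    ∑-zero g≈0 []       = refl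
    ∑-zero g≈0 (x ∷ xs) = trans (+-cong (g≈0 x) (∑-zero g≈0 xs)) (+-identityˡ 0#)

    ∑-+ : ∀ (g h : A → Carrier) xs → ∑ (λ x → g x + h x) xs ≈ ∑ g xs + ∑ h xs
    ∑-+ g h []       = sym (+-identityˡ 0#)
    ∑-+ g h (x ∷ xs) = trans (+-congˡ (∑-+ g h xs))
      (solve 4 (λ p q r s → (p :+ q) :+ (r :+ s) := (p :+ r) :+ (q :+ s)) refl
        (g x) (h x) (∑ g xs) (∑ h xs))

    *-∑ : ∀ b (g : A → Carrier) xs → b * ∑ g xs ≈ ∑ (λ x → b * g x) xs
    *-∑ b g []       = zeroʳ b
    *-∑ b g (x ∷ xs) = trans (distribˡ b (g x) (∑ g xs)) (+-congˡ (*-∑ b g xs))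

    ∑-* : ∀ (g : A → Carrier) b xs → ∑ g xs * b ≈ ∑ (λ x → g x * b) xs
    ∑-* g b []       = zeroˡ b
    ∑-* g b (x ∷ xs) = trans (distribʳ b (g x) (∑ g xs)) (+-congˡ (∑-* g b xs))

    ∑-++ : ∀ (g : A → Carrier) xs ys → ∑ g (xs ++ ys) ≈ ∑ g xs + ∑ g ys
    ∑-++ g []       ys = sym (+-identityˡ (∑ g ys))
    ∑-++ g (x ∷ xs) ys = trans (+-congˡ (∑-++ g xs ys)) (sym (+-assoc (g x) (∑ g xs) (∑ g ys)))

    ∑-filter : ∀ {p} {P : Pred A p} (P? : Decidable P) {g h : A → Carrier} →
      (∀ x → P x → g x ≈ h x) → (∀ x → ¬ P x → h x ≈ 0#) →
      ∀ xs → ∑ g (List.filter P? xs) ≈ ∑ h xs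
    ∑-filter P? {g} {h} on off []       = refl
    ∑-filter P? {g} {h} on off (x ∷ xs) with P? x
    ... | yes px = +-cong (on x px) (∑-filter P? on off xs)
    ... | no ¬px = trans (∑-filter P? on off xs)
      (sym (trans (+-congʳ (off x ¬px)) (+-identityˡ (∑ h xs))))

  ∑-map : ∀ {a b} {A : Set a} {B : Set b} (u : A → B) (g : B → Carrier) xs →
    ∑ g (List.map u xs) ≈ ∑ (g ∘ u) xs
  ∑-map u g []       = refl
  ∑-map u g (x ∷ xs) = +-congˡ (∑-map u g xs)

  ∑-swap : ∀ {a b} {A : Set a} {B : Set b} (g : A → B → Carrier) xs ys →
    ∑ (λ x → ∑ (g x) ys) xs ≈ ∑ (λ y → ∑ (λ x → g x y) xs) ys
  ∑-swap g []       ys = sym (∑-zero (λ _ → refl) ys)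
  ∑-swap g (x ∷ xs) ys = trans (+-congˡ (∑-swap g xs ys))
    (sym (∑-+ (g x) (λ y → ∑ (λ z → g z y) xs) ys))

-- Linear functionals on formal polynomials.

module LinearFunctionals {c ℓ} (R : CommutativeRing c ℓ) where

  open CommutativeRing R hiding (zero)
  open Polynomials R
  open ListSums R
  open import Relation.Binary.Reasoning.Setoid setoid

  -- The linear functional on polynomials with value φ α at the monomial x^α.
  weigh : ∀ {n} → (Exponent n → Carrier) → Polynomial n → Carrier
  weigh φ = ∑ λ (a , α) → a * φ α

  δ : ∀ {n} → Exponent n → Exponent n → Carrier
  δ β α = if does (≡-dec ℕ._≟_ α β) then 1# else 0#

  δ-refl : ∀ {n} (β α : Exponent n) → α ≡ β → δ β α ≈ 1#
  δ-refl β α α≡β with ≡-dec ℕ._≟_ α β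
  ... | yes _  = refl
  ... | no α≢β = contradiction α≡β α≢β

  δ-≢ : ∀ {n} (β α : Exponent n) → α ≢ β → δ β α ≈ 0#
  δ-≢ β α α≢β with ≡-dec ℕ._≟_ α β
  ... | yes α≡β = contradiction α≡β α≢β
  ... | no _    = refl

  δ-∷ : ∀ {n} b (β α : Exponent n) → δ (b ∷ β) (b ∷ α) ≈ δ β α
  δ-∷ b β α = by-cases (≡-dec ℕ._≟_ α β)
    where
    by-cases : Dec (α ≡ β) → δ (b ∷ β) (b ∷ α) ≈ δ β α
    by-cases (yes α≡β) = trans (δ-refl (b ∷ β) (b ∷ α) (cong (b ∷_) α≡β)) (sym (δ-refl β α α≡β))
    by-cases (no α≢β)  = trans (δ-≢ (b ∷ β) (b ∷ α) (α≢β ∘ ∷-injectiveʳ)) (sym (δ-≢ β α α≢β))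

  coeff≈weigh : ∀ {n} (f : Polynomial n) β → coeff f β ≈ weigh (δ β) f
  coeff≈weigh []             β = refl
  coeff≈weigh ((a , α) ∷ f) β with ≡-dec ℕ._≟_ α β
  ... | yes _ = +-cong (sym (*-identityʳ a)) (coeff≈weigh f β)
  ... | no _  = trans (coeff≈weigh f β)
    (trans (sym (+-identityˡ _)) (+-congʳ (sym (zeroʳ a))))

  weigh-cong : ∀ {n} {φ ψ : Exponent n → Carrier} → (∀ α → φ α ≈ ψ α) →
    ∀ f → weigh φ f ≈ weigh ψ f
  weigh-cong φ≈ψ = ∑-cong (λ (a , α) → *-congˡ (φ≈ψ α))

  weigh-*ʳ : ∀ {n} (φ : Exponent n → Carrier) b f →
    weigh (λ α → φ α * b) f ≈ weigh φ f * b
  weigh-*ʳ φ b f = trans (∑-cong (λ (a , α) → sym (*-assoc a (φ α) b)) f)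
    (sym (∑-* (λ (a , α) → a * φ α) b f))

  ∑-weigh : ∀ {n a} {A : Set a} (φ : A → Exponent n → Carrier) xs f →
    ∑ (λ x → weigh (φ x) f) xs ≈ weigh (λ α → ∑ (λ x → φ x α) xs) f
  ∑-weigh φ xs f = trans (∑-swap (λ x (a , α) → a * φ x α) xs f)
    (∑-cong (λ (a , α) → sym (*-∑ a (λ x → φ x α) xs)) f)

  ∑-δ-∉ : ∀ {n} (φ : Exponent n → Carrier) {α} βs → α ∉ βs → ∑ (λ β → δ β α * φ β) βs ≈ 0#
  ∑-δ-∉ φ []       α∉ = refl
  ∑-δ-∉ φ (β ∷ βs) α∉ = trans
    (+-cong (trans (*-congʳ (δ-≢ β _ (α∉ ∘ here))) (zeroˡ (φ β))) (∑-δ-∉ φ βs (α∉ ∘ there)))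
    (+-identityˡ 0#)

  ∑-δ-∈ : ∀ {n} (φ : Exponent n → Carrier) {α βs} → Unique βs → α ∈ βs →
    ∑ (λ β → δ β α * φ β) βs ≈ φ α
  ∑-δ-∈ φ {α} {β ∷ βs} (β∉ ∷ _) (here ≡.refl) = trans
    (+-cong (trans (*-congʳ (δ-refl β β ≡.refl)) (*-identityˡ (φ β)))
      (∑-δ-∉ φ βs (All¬⇒¬Any β∉)))
    (+-identityʳ (φ α))
  ∑-δ-∈ φ {α} {β ∷ βs} (β∉ ∷ u) (there α∈) = trans
    (+-cong
      (trans (*-congʳ (δ-≢ β α (λ α≡β → All¬⇒¬Any β∉ (subst (_∈ βs) α≡β α∈)))) (zeroˡ (φ β)))
      (∑-δ-∈ φ u α∈))
    (+-identityˡ (φ α))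

  -- Exchanging the sums, each term of f finds its exponent exactly once in `βs`; repeated exponents
  -- of f are thereby collected into one coefficient.
  weigh-expand : ∀ {n} (φ : Exponent n → Carrier) {βs} → Unique βs →
    ∀ f → All (λ (_ , α) → α ∈ βs) f → weigh φ f ≈ ∑ (λ β → coeff f β * φ β) βs
  weigh-expand φ {βs} u f f⊆ = sym (begin
    ∑ (λ β → coeff f β * φ β) βs                ≈⟨ ∑-cong (λ β → *-congʳ (coeff≈weigh f β)) βs ⟩
    ∑ (λ β → weigh (δ β) f * φ β) βs            ≈⟨ ∑-cong (λ β → weigh-*ʳ (δ β) (φ β) f) βs ⟨
    ∑ (λ β → weigh (λ α → δ β α * φ β) f) βs    ≈⟨ ∑-weigh (λ β α → δ β α * φ β) βs f ⟩
    weigh (λ α → ∑ (λ β → δ β α * φ β) βs) f    ≈⟨ collapse f f⊆ ⟩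
    weigh φ f                                   ∎)
    where
    collapse : ∀ g → All (λ (_ , α) → α ∈ βs) g →
      weigh (λ α → ∑ (λ β → δ β α * φ β) βs) g ≈ weigh φ g
    collapse []      []        = refl
    collapse (_ ∷ g) (α∈ ∷ g⊆) = +-cong (*-congˡ (∑-δ-∈ φ u α∈)) (collapse g g⊆)

  exponents : ∀ {n} → Polynomial n → List (Exponent n)
  exponents f = deduplicate (≡-dec ℕ._≟_) (List.map proj₂ f)

  -- The right-hand side sees f through its coefficients, to which hypotheses such as `Homogeneous`
  -- apply.
  weigh-exponents : ∀ {n} (φ : Exponent n → Carrier) f →
    weigh φ f ≈ ∑ (λ β → coeff f β * φ β) (exponents f)
  weigh-exponents φ f = weigh-expand φ (deduplicate-! (≡-dec ℕ._≟_) (List.map proj₂ f)) f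
    (All.tabulate λ t∈f → ∈-deduplicate⁺ (≡-dec ℕ._≟_) (∈-map⁺ proj₂ t∈f))
    where open import Data.List.Relation.Unary.Unique.DecPropositional.Properties using (deduplicate-!)

  -- f may contain terms of the wrong degree, which cancel, so the sums
  -- cannot be compared term by term.
  weigh-homogeneous : ∀ {n d} {φ ψ : Exponent n → Carrier} f → Homogeneous d f →
    (∀ α → Vec.sum α ≡ d → φ α ≈ ψ α) → weigh φ f ≈ weigh ψ f
  weigh-homogeneous {d = d} {φ} {ψ} f hom φ≈ψ = begin
    weigh φ f                                ≈⟨ weigh-exponents φ f ⟩
    ∑ (λ β → coeff f β * φ β) (exponents f)  ≈⟨ ∑-cong agree (exponents f) ⟩
    ∑ (λ β → coeff f β * ψ β) (exponents f)  ≈⟨ weigh-exponents ψ f ⟨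
    weigh ψ f                                ∎
    where
    agree : ∀ β → coeff f β * φ β ≈ coeff f β * ψ β
    agree β with Vec.sum β ℕ.≟ d
    ... | yes Σβ≡d = *-congˡ (φ≈ψ β Σβ≡d)
    ... | no  Σβ≢d = trans (*-congʳ (hom β Σβ≢d))
      (trans (zeroˡ _) (sym (trans (*-congʳ (hom β Σβ≢d)) (zeroˡ _))))

-- Partial row sums of Pascal's triangle.

binomialSum-suc : ∀ n k →
  binomialSum n (suc k) ≡ n C 0 ℕ.+ sum (applyUpTo (λ i → n C suc i) (suc k))
binomialSum-suc n k = cong (λ cs → n C 0 ℕ.+ sum cs) (map-applyUpTo suc (n C_) (suc k))

sum-applyUpTo-+ : ∀ (f g : ℕ → ℕ) k →
  sum (applyUpTo f k) ℕ.+ sum (applyUpTo g k) ≡ sum (applyUpTo (λ i → f i ℕ.+ g i) k)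
sum-applyUpTo-+ f g zero    = ≡.refl
sum-applyUpTo-+ f g (suc k) = ≡.trans
  (solve 4 (λ a b c d → a :+ b :+ (c :+ d) := a :+ c :+ (b :+ d)) ≡.refl
    (f 0) (sum (applyUpTo (f ∘ suc) k)) (g 0) (sum (applyUpTo (g ∘ suc) k)))
  (cong (f 0 ℕ.+ g 0 ℕ.+_) (sum-applyUpTo-+ (f ∘ suc) (g ∘ suc) k))
  where open ℕSolver

sum-applyUpTo-cong : ∀ {f g : ℕ → ℕ} → (∀ i → f i ≡ g i) → ∀ k →
  sum (applyUpTo f k) ≡ sum (applyUpTo g k)
sum-applyUpTo-cong f≡g zero    = ≡.refl
sum-applyUpTo-cong f≡g (suc k) = cong₂ ℕ._+_ (f≡g 0) (sum-applyUpTo-cong (f≡g ∘ suc) k)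

binomialSum-zeroˡ : ∀ k → binomialSum 0 k ≡ 1
binomialSum-zeroˡ zero    = ≡.refl
binomialSum-zeroˡ (suc k) = ≡.trans (binomialSum-suc 0 k) (cong suc (zeros (suc k) {0}))
  where
  -- The offset `j` makes the induction go through, as `applyUpTo` shifts its function at every
  -- step.
  zeros : ∀ k {j} → sum (applyUpTo (λ i → 0 C suc (j ℕ.+ i)) k) ≡ 0
  zeros zero        = ≡.refl
  zeros (suc k) {j} = ≡.trans
    (sum-applyUpTo-cong (λ i → cong (λ m → 0 C suc m) (ℕ.+-suc j i)) k) (zeros k {suc j})

binomialSum-pascal : ∀ n k →
  binomialSum n (suc k) ℕ.+ binomialSum n k ≡ binomialSum (suc n) (suc k)
binomialSum-pascal n k = begin
  binomialSum n (suc k) ℕ.+ binomialSum n k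
    ≡⟨ cong₂ ℕ._+_ (binomialSum-suc n k) (cong sum (map-applyUpTo id (n C_) (suc k))) ⟩
  n C 0 ℕ.+ sum (applyUpTo (λ i → n C suc i) (suc k)) ℕ.+ sum (applyUpTo (n C_) (suc k))
    ≡⟨ ℕ.+-assoc (n C 0) (sum (applyUpTo (λ i → n C suc i) (suc k))) _ ⟩
  n C 0 ℕ.+ (sum (applyUpTo (λ i → n C suc i) (suc k)) ℕ.+ sum (applyUpTo (n C_) (suc k)))
    ≡⟨ cong (n C 0 ℕ.+_) (≡.trans (sum-applyUpTo-+ (λ i → n C suc i) (n C_) (suc k))
         (sum-applyUpTo-cong
           (λ i → ≡.trans (ℕ.+-comm (n C suc i) (n C i)) (nCk+nC[k+1]≡[n+1]C[k+1] n i)) (suc k))) ⟩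
  -- The leading terms `n C 0` and `suc n C 0` agree by computation.
  suc n C 0 ℕ.+ sum (applyUpTo (λ i → suc n C suc i) (suc k))
    ≡⟨ binomialSum-suc (suc n) k ⟨
  binomialSum (suc n) (suc k) ∎
  where open ≡.≡-Reasoning

-- Parities and halves of exponents.

parity : ℕ → ℕ
parity zero          = 0
parity (suc zero)    = 1
parity (suc (suc a)) = parity a

-- These are the m and the e of the overview. `halfSum α` is 0 exactly when every exponent is at
-- most 1.
oddCount halfSum : ∀ {n} → Vec ℕ n → ℕ
oddCount = Vec.sum ∘ Vec.map parity
halfSum  = Vec.sum ∘ Vec.map ⌊_/2⌋

parity+half : ∀ a → parity a ℕ.+ (⌊ a /2⌋ ℕ.+ ⌊ a /2⌋) ≡ a
parity+half zero          = ≡.refl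
parity+half (suc zero)    = ≡.refl
parity+half (suc (suc a)) = ≡.trans
  (solve 2 (λ p h → p :+ (con 1 :+ h :+ (con 1 :+ h)) := con 2 :+ (p :+ (h :+ h))) ≡.refl
    (parity a) ⌊ a /2⌋)
  (cong (2 ℕ.+_) (parity+half a))
  where open ℕSolver

oddCount+halfSum : ∀ {n} (α : Vec ℕ n) → oddCount α ℕ.+ (halfSum α ℕ.+ halfSum α) ≡ Vec.sum α
oddCount+halfSum []      = ≡.refl
oddCount+halfSum (a ∷ α) = ≡.trans
  (solve 4 (λ p o h s → p :+ o :+ (h :+ s :+ (h :+ s)) := p :+ (h :+ h) :+ (o :+ (s :+ s))) ≡.refl
    (parity a) (oddCount α) ⌊ a /2⌋ (halfSum α))
  (cong₂ ℕ._+_ (parity+half a) (oddCount+halfSum α))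
  where open ℕSolver

halfSum≤⌊sum/2⌋ : ∀ {n} (α : Vec ℕ n) → halfSum α ℕ.≤ ⌊ Vec.sum α /2⌋
halfSum≤⌊sum/2⌋ α = subst (ℕ._≤ ⌊ Vec.sum α /2⌋) (≡.sym (ℕ.n≡⌊n+n/2⌋ (halfSum α)))
  (ℕ.⌊n/2⌋-mono (subst (halfSum α ℕ.+ halfSum α ℕ.≤_) (oddCount+halfSum α)
    (ℕ.m≤n+m (halfSum α ℕ.+ halfSum α) (oddCount α))))

excess-zero : ∀ a {s t} → s ℕ.≤ t → a ℕ.+ t ≡ s → a ≡ 0
excess-zero a {s} {t} s≤t eq =
  ℕ.n≤0⇒n≡0 (ℕ.+-cancelʳ-≤ t a 0 (subst (ℕ._≤ t) (≡.sym eq) s≤t))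

-- Multilinear coefficients and the operator e_{n,d}(∂x).

module Multilinear {c ℓ} (R : CommutativeRing c ℓ) where

  open CommutativeRing R hiding (zero)
  open Polynomials R
  open RawSemiringDefinitions (Semiring.rawSemiring semiring) using () renaming (_×_ to _·_)
  open SemiringMultProperties semiring using (×-assoc-*; ×-congʳ)
  open ListSums R
  open LinearFunctionals R
  open import Relation.Binary.Reasoning.Setoid setoid

  sum-indicator : ∀ {n} (S : Subset n) → Vec.sum (indicator S) ≡ size S
  sum-indicator []          = ≡.refl
  sum-indicator (true ∷ S)  = cong suc (sum-indicator S)
  sum-indicator (false ∷ S) = sum-indicator S

  halfSum-indicator : ∀ {n} (S : Subset n) → halfSum (indicator S) ≡ 0
  halfSum-indicator []          = ≡.refl
  halfSum-indicator (true ∷ S)  = halfSum-indicator S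
  halfSum-indicator (false ∷ S) = halfSum-indicator S

  private
    δ-indicator-∷ : ∀ {n} s a (α : Exponent n) →
      ∑ (λ S → δ (indicator S) (a ∷ α)) (List.map (s ∷_) (subsets n)) ≈
      ∑ (λ S → δ ((if s then 1 else 0) ∷ indicator S) (a ∷ α)) (subsets n)
    δ-indicator-∷ {n} s a α = ∑-map (s ∷_) (λ S → δ (indicator S) (a ∷ α)) (subsets n)

    δ-head-≢ : ∀ {n} a b (α : Exponent n) → a ≢ b →
      ∑ (λ S → δ (b ∷ indicator S) (a ∷ α)) (subsets n) ≈ 0#
    δ-head-≢ {n} a b α a≢b =
      ∑-zero (λ S → δ-≢ (b ∷ indicator S) (a ∷ α) (a≢b ∘ ∷-injectiveˡ)) (subsets n)

  -- Such an α is the indicator of exactly one subset, and its first entry tells which half of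
  -- `subsets` holds it. A first entry of 2 or more contradicts the hypothesis.
  ∑-δ-multilinear : ∀ {n} (α : Exponent n) → halfSum α ≡ 0 →
    ∑ (λ S → δ (indicator S) α) (subsets n) ≈ 1#
  ∑-δ-multilinear []                _   = +-identityʳ 1#
  ∑-δ-multilinear {suc n} (zero ∷ α) h≡0 = begin
    ∑ (λ S → δ (indicator S) (0 ∷ α)) (subsets (suc n))
      ≈⟨ ∑-++ _ (List.map (outside ∷_) (subsets n)) _ ⟩
    _ ≈⟨ +-cong (δ-indicator-∷ outside 0 α) (δ-indicator-∷ inside 0 α) ⟩
    _ ≈⟨ +-cong (∑-cong (λ S → δ-∷ 0 (indicator S) α) (subsets n)) (δ-head-≢ 0 1 α (λ ())) ⟩
    _ ≈⟨ +-identityʳ _ ⟩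
    _ ≈⟨ ∑-δ-multilinear α h≡0 ⟩
    1# ∎
  ∑-δ-multilinear {suc n} (suc zero ∷ α) h≡0 = begin
    ∑ (λ S → δ (indicator S) (1 ∷ α)) (subsets (suc n))
      ≈⟨ ∑-++ _ (List.map (outside ∷_) (subsets n)) _ ⟩
    _ ≈⟨ +-cong (δ-indicator-∷ outside 1 α) (δ-indicator-∷ inside 1 α) ⟩
    _ ≈⟨ +-cong (δ-head-≢ 1 0 α (λ ())) (∑-cong (λ S → δ-∷ 1 (indicator S) α) (subsets n)) ⟩
    _ ≈⟨ +-identityˡ _ ⟩
    _ ≈⟨ ∑-δ-multilinear α h≡0 ⟩
    1# ∎

  ∑-δ-nonmultilinear : ∀ {n} (α : Exponent n) → halfSum α ≢ 0 →
    ∑ (λ S → δ (indicator S) α) (subsets n) ≈ 0#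
  ∑-δ-nonmultilinear {n} α h≢0 = ∑-zero
    (λ S → δ-≢ (indicator S) α λ α≡S → h≢0 (≡.trans (cong halfSum α≡S) (halfSum-indicator S)))
    (subsets n)

  multilinearSum≈weigh : ∀ {n} (f : Polynomial n) →
    multilinearSum f ≈ weigh (λ α → ∑ (λ S → δ (indicator S) α) (subsets n)) f
  multilinearSum≈weigh {n} f = trans
    (∑-cong (λ S → coeff≈weigh f (indicator S)) (subsets n))
    (∑-weigh (λ S → δ (indicator S)) (subsets n) f)

  Term : ℕ → Set c
  Term n = Carrier × Exponent n

  ∂-term : ∀ {n} → Fin n → Term n → Term n
  ∂-term i (a , α) = (lookup α i · a) , updateAt α i pred

  ∂^-term : ∀ {n} → Exponent n → List (Fin n) → Term n → Term n
  ∂^-term β is t = List.foldr (λ i u → iterate (∂-term i) u (lookup β i)) t is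

  iterate-∂ : ∀ {n} (i : Fin n) k f →
    iterate (∂ i) f k ≡ List.map (λ t → iterate (∂-term i) t k) f
  iterate-∂ i zero    f = ≡.sym (map-id f)
  iterate-∂ i (suc k) f = ≡.trans (iterate-∂ i k (∂ i f)) (≡.sym (map-∘ f))

  ∂^≡map : ∀ {n} (β : Exponent n) f → ∂^ β f ≡ List.map (∂^-term β (List.allFin n)) f
  ∂^≡map {n} β f = go (List.allFin n)
    where
    go : ∀ is → List.foldr (λ i h → iterate (∂ i) h (lookup β i)) f is ≡
      List.map (∂^-term β is) f
    go []       = ≡.sym (map-id f)
    go (i ∷ is) = ≡.trans (cong (λ h → iterate (∂ i) h (lookup β i)) (go is))
      (≡.trans (iterate-∂ i (lookup β i) (List.map (∂^-term β is) f)) (≡.sym (map-∘ f)))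

  -- Such a map on terms is determined by its effect on monic monomials. All compositions of partial
  -- derivatives and scalings are of this kind.
  CoefficientLinear : ∀ {n} → (Term n → Term n) → Set _
  CoefficientLinear T = ∀ a α →
    proj₁ (T (a , α)) ≈ a * proj₁ (T (1# , α)) × proj₂ (T (a , α)) ≡ proj₂ (T (1# , α))

  module _ {n : ℕ} where

    id-linear : CoefficientLinear {n} id
    id-linear a α = sym (*-identityʳ a) , ≡.refl

    ∘-linear : ∀ {T U : Term n → Term n} →
      CoefficientLinear T → CoefficientLinear U → CoefficientLinear (T ∘ U)
    ∘-linear {T} {U} T-linear U-linear a α with U (a , α) | U-linear a α
    ... | b , β | b≈ , ≡.refl =
      let b′ , β′ = U (1# , α) in
      (begin
        proj₁ (T (b , β′))                   ≈⟨ proj₁ (T-linear b β′) ⟩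
        b * proj₁ (T (1# , β′))              ≈⟨ *-congʳ b≈ ⟩
        a * b′ * proj₁ (T (1# , β′))         ≈⟨ *-assoc a b′ _ ⟩
        a * (b′ * proj₁ (T (1# , β′)))       ≈⟨ *-congˡ (proj₁ (T-linear b′ β′)) ⟨
        a * proj₁ (T (b′ , β′))              ∎) ,
      ≡.trans (proj₂ (T-linear b β′)) (≡.sym (proj₂ (T-linear b′ β′)))

    ∂-term-linear : ∀ i → CoefficientLinear {n} (∂-term i)
    ∂-term-linear i a α = sym (begin
      a * (k · 1#) ≈⟨ *-comm a (k · 1#) ⟩
      k · 1# * a   ≈⟨ ×-assoc-* k 1# a ⟩
      k · (1# * a) ≈⟨ ×-congʳ k (*-identityˡ a) ⟩
      k · a        ∎) , ≡.refl
      where k = lookup α i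

    iterate-linear : ∀ {T : Term n → Term n} → CoefficientLinear T →
      ∀ k → CoefficientLinear (λ t → iterate T t k)
    iterate-linear T-linear zero    = id-linear
    iterate-linear T-linear (suc k) = ∘-linear (iterate-linear T-linear k) T-linear

    ∂^-term-linear : ∀ (β : Exponent n) is → CoefficientLinear (∂^-term β is)
    ∂^-term-linear β []       = id-linear
    ∂^-term-linear β (i ∷ is) =
      ∘-linear (iterate-linear (∂-term-linear i) (lookup β i)) (∂^-term-linear β is)

  -- The weight at α is the coefficient of x^γ in the image of x^α, so a coefficient of a derivative
  -- of f becomes a functional on f itself.
  coeff-map : ∀ {n} {T : Term n → Term n} → CoefficientLinear T → ∀ f γ →
    coeff (List.map T f) γ ≈
    weigh (λ α → proj₁ (T (1# , α)) * δ γ (proj₂ (T (1# , α)))) f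
  coeff-map {n} {T} T-linear f γ = begin
    coeff (List.map T f) γ                              ≈⟨ coeff≈weigh (List.map T f) γ ⟩
    weigh (δ γ) (List.map T f)                          ≈⟨ ∑-map T (λ (a , α) → a * δ γ α) f ⟩
    ∑ (λ t → proj₁ (T t) * δ γ (proj₂ (T t))) f         ≈⟨ ∑-cong step f ⟩
    weigh (λ α → proj₁ (T (1# , α)) * δ γ (proj₂ (T (1# , α)))) f ∎
    where
    step : ∀ ((a , α) : Term n) → proj₁ (T (a , α)) * δ γ (proj₂ (T (a , α))) ≈
      a * (proj₁ (T (1# , α)) * δ γ (proj₂ (T (1# , α))))
    step (a , α) = trans
      (*-cong (proj₁ (T-linear a α)) (reflexive (cong (δ γ) (proj₂ (T-linear a α)))))
      (*-assoc a _ _)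

  lookup-indicator : ∀ {n} (S : Subset n) i →
    lookup (indicator S) i ≡ (if lookup S i then 1 else 0)
  lookup-indicator S i = lookup-map i (λ s → if s then 1 else 0) S

  indicator-0-or-1 : ∀ {n} (S : Subset n) i →
    lookup (indicator S) i ≡ 0 ⊎ lookup (indicator S) i ≡ 1
  indicator-0-or-1 S i with lookup S i | lookup-indicator S i
  ... | true  | eq = inj₂ eq
  ... | false | eq = inj₁ eq

  -- Deriving x^k k times brings down the factor k!, which is 1 for k at most 1.
  ∂-term-exhaust : ∀ {n} i k → k ≡ 0 ⊎ k ≡ 1 → ∀ a (α : Exponent n) → lookup α i ≡ k →
    let b , β = iterate (∂-term i) (a , α) k in
    b ≈ a × lookup β i ≡ 0 × (∀ j → j ≢ i → lookup β j ≡ lookup α j)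
  ∂-term-exhaust i _ (inj₁ ≡.refl) a α αᵢ≡0 = refl , αᵢ≡0 , λ _ _ → ≡.refl
  ∂-term-exhaust i _ (inj₂ ≡.refl) a α αᵢ≡1 =
    trans (reflexive (cong (_· a) αᵢ≡1)) (+-identityʳ a) ,
    ≡.trans (lookup∘updateAt i α) (cong pred αᵢ≡1) ,
    λ j j≢i → lookup∘updateAt′ j i j≢i α

  -- ∏_{i ∈ S} ∂/∂xᵢ takes ∏_{i ∈ S} xᵢ to 1.
  ∂^-indicator : ∀ {n} (S : Subset n) a {is} → Unique is →
    let b , β = ∂^-term (indicator S) is (a , indicator S) in
    b ≈ a × (∀ j → j ∈ is → lookup β j ≡ 0) ×
    (∀ j → j ∉ is → lookup β j ≡ lookup (indicator S) j)
  ∂^-indicator S a [] = refl , (λ _ ()) , λ _ _ → ≡.refl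
  ∂^-indicator S a {i ∷ is} (i∉ ∷ u) =
    let b , β = ∂^-term (indicator S) is (a , indicator S)
        b≈a , on , off = ∂^-indicator S a u
        b′≈b , at , away = ∂-term-exhaust i (lookup (indicator S) i) (indicator-0-or-1 S i)
          b β (off i (All¬⇒¬Any i∉))
    in trans b′≈b b≈a ,
       (λ where
         j (here ≡.refl) → at
         j (there j∈is)  → ≡.trans
           (away j (λ j≡i → All¬⇒¬Any i∉ (subst (_∈ is) j≡i j∈is))) (on j j∈is)) ,
       λ j j∉ → ≡.trans (away j (j∉ ∘ here)) (off j (j∉ ∘ there))

  -- An absent variable stays absent: `pred 0` is 0, and other derivatives do not touch its
  -- exponent.
  lookup-iterate-∂-term : ∀ {n} {i : Fin n} j k (t : Term n) →
    lookup (proj₂ t) i ≡ 0 → lookup (proj₂ (iterate (∂-term j) t k)) i ≡ 0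
  lookup-iterate-∂-term         j zero    t         αᵢ≡0 = αᵢ≡0
  lookup-iterate-∂-term {i = i} j (suc k) t@(a , α) αᵢ≡0 =
    lookup-iterate-∂-term j k (∂-term j t) stays-zero
    where
    stays-zero : lookup (updateAt α j pred) i ≡ 0
    stays-zero with i Fin.≟ j
    ... | yes ≡.refl = ≡.trans (lookup∘updateAt i α) (cong pred αᵢ≡0)
    ... | no i≢j     = ≡.trans (lookup∘updateAt′ i j i≢j α) αᵢ≡0

  lookup-∂^-term : ∀ {n} {i : Fin n} β is (t : Term n) →
    lookup (proj₂ t) i ≡ 0 → lookup (proj₂ (∂^-term β is t)) i ≡ 0
  lookup-∂^-term β []       t αᵢ≡0 = αᵢ≡0
  lookup-∂^-term β (j ∷ is) t αᵢ≡0 =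
    lookup-iterate-∂-term j (lookup β j) (∂^-term β is t) (lookup-∂^-term β is t αᵢ≡0)

  iterate-∂-term-zero : ∀ {n} (i : Fin n) k t →
    proj₁ t ≈ 0# → proj₁ (iterate (∂-term i) t k) ≈ 0#
  iterate-∂-term-zero i zero    t         a≈0 = a≈0
  iterate-∂-term-zero i (suc k) t@(a , α) a≈0 = iterate-∂-term-zero i k (∂-term i t)
    -- A multiple of 0 vanishes because 0 can be written as a product with 0.
    (trans (×-congʳ m a≈0) (trans (×-congʳ m (sym (zeroˡ 0#)))
      (trans (sym (×-assoc-* m 0# 0#)) (zeroʳ (m · 0#)))))
    where m = lookup α i

  -- The derivatives later in the list act first and keep the exponent of variable i at 0. Then the
  -- derivative in direction i brings down the factor 0, and the remaining ones preserve the zero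
  -- coefficient.
  ∂^-term-annihilates : ∀ {n} {i : Fin n} β {is} t → lookup β i ≡ 1 → lookup (proj₂ t) i ≡ 0 →
    i ∈ is → proj₁ (∂^-term β is t) ≈ 0#
  ∂^-term-annihilates {i = i} β {is = i ∷ is} t βᵢ≡1 αᵢ≡0 (here ≡.refl)
    rewrite βᵢ≡1 | lookup-∂^-term β is t αᵢ≡0 = refl
  ∂^-term-annihilates β {is = j ∷ is} t βᵢ≡1 αᵢ≡0 (there i∈is) =
    iterate-∂-term-zero j (lookup β j) (∂^-term β is t)
      (∂^-term-annihilates β t βᵢ≡1 αᵢ≡0 i∈is)

  -- Without a missing variable, α dominates the indicator of S in every coordinate, and equal sums
  -- then force equality.
  missing-or-bounded : ∀ {n} (S : Subset n) (α : Exponent n) →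
    (∃[ i ] lookup (indicator S) i ≡ 1 × lookup α i ≡ 0) ⊎
    (size S ℕ.≤ Vec.sum α × (Vec.sum α ≡ size S → α ≡ indicator S))
  missing-or-bounded [] [] = inj₂ (z≤n , λ _ → ≡.refl)
  missing-or-bounded (s ∷ S) (a ∷ α) with missing-or-bounded S α
  missing-or-bounded (s ∷ S) (a ∷ α) | inj₁ (i , on , off) = inj₁ (suc i , on , off)
  missing-or-bounded (true ∷ S) (zero ∷ α) | inj₂ _ = inj₁ (zero , ≡.refl , ≡.refl)
  missing-or-bounded (true ∷ S) (suc a ∷ α) | inj₂ (S≤α , tight) =
    inj₂ (s≤s (ℕ.≤-trans S≤α (ℕ.m≤n+m _ a)) , λ eq →
      let eq′ = ℕ.suc-injective eq
          a≡0 = excess-zero a S≤α eq′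
      in cong₂ _∷_ (cong suc a≡0) (tight (subst (λ b → b ℕ.+ Vec.sum α ≡ size S) a≡0 eq′)))
  missing-or-bounded (false ∷ S) (a ∷ α) | inj₂ (S≤α , tight) =
    inj₂ (ℕ.≤-trans S≤α (ℕ.m≤n+m _ a) , λ eq →
      let a≡0 = excess-zero a S≤α eq
      in cong₂ _∷_ a≡0 (tight (subst (λ b → b ℕ.+ Vec.sum α ≡ size S) a≡0 eq)))

  lookup-zero : ∀ {n} (α : Exponent n) → (∀ i → lookup α i ≡ 0) → α ≡ replicate n 0
  lookup-zero []      _    = ≡.refl
  lookup-zero (a ∷ α) α≡0 = cong₂ _∷_ (α≡0 zero) (lookup-zero α (α≡0 ∘ suc))

  -- In degree `size S`, every monomial other than that of S misses a variable of S and is killed.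
  -- The degree condition excludes proper multiples of the monomial of S, whose derivatives need not
  -- be constant.
  ∂^-indicator-coeff : ∀ {n} (S : Subset n) (α γ : Exponent n) → Vec.sum α ≡ size S →
    let b , β = ∂^-term (indicator S) (List.allFin n) (1# , α) in
    1# * b * δ γ β ≈ δ (indicator S) α * δ γ (replicate n 0)
  ∂^-indicator-coeff {n} S α γ Σα≡∣S∣ with missing-or-bounded S α
  ... | inj₁ (i , on , off) = trans
    (*-congʳ (trans (*-identityˡ _)
      (∂^-term-annihilates (indicator S) (1# , α) on off (∈-allFin i))))
    (trans (zeroˡ _) (sym (trans (*-congʳ (δ-≢ (indicator S) α α≢S)) (zeroˡ _))))
    where
    α≢S : α ≢ indicator S
    α≢S α≡S with ≡.trans (≡.sym on) (≡.trans (cong (λ β → lookup β i) (≡.sym α≡S)) off)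
    ... | ()
  ... | inj₂ (_ , tight) with tight Σα≡∣S∣
  ... | ≡.refl =
    let b≈1 , on , _ = ∂^-indicator S 1# (allFin⁺ n)
    in *-cong
      (trans (*-identityˡ _) (trans b≈1 (sym (δ-refl (indicator S) (indicator S) ≡.refl))))
      (reflexive (cong (δ γ)
        (lookup-zero (proj₂ (∂^-term (indicator S) (List.allFin n) (1# , indicator S)))
          (λ i → on i (∈-allFin i)))))

  scale : ∀ {n} → Carrier → Polynomial n → Polynomial n
  scale b = List.map (λ (a , α) → (b * a) , α)

  coeff-++ : ∀ {n} (f g : Polynomial n) γ → coeff (f ++ g) γ ≈ coeff f γ + coeff g γ
  coeff-++ f g γ = trans (coeff≈weigh (f ++ g) γ)
    (trans (∑-++ _ f g) (sym (+-cong (coeff≈weigh f γ) (coeff≈weigh g γ))))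

  coeff-⟨∂𝐱⟩ : ∀ {n} (g f : Polynomial n) γ →
    coeff (g ⟨∂𝐱⟩ f) γ ≈ ∑ (λ (b , β) → coeff (scale b (∂^ β f)) γ) g
  coeff-⟨∂𝐱⟩ []             f γ = refl
  coeff-⟨∂𝐱⟩ ((b , β) ∷ g) f γ = trans
    (coeff-++ (scale b (∂^ β f)) (g ⟨∂𝐱⟩ f) γ)
    (+-congˡ (coeff-⟨∂𝐱⟩ g f γ))

  coeff-constant : ∀ {n} a (γ : Exponent n) → coeff (constant a) γ ≈ a * δ γ (replicate n 0)
  coeff-constant a γ = trans (coeff≈weigh (constant a) γ) (+-identityʳ _)

  coeff-∂^-indicator : ∀ {n d} {f : Polynomial n} → Homogeneous d f →
    ∀ S γ → size S ≡ d →
    coeff (scale 1# (∂^ (indicator S) f)) γ ≈ coeff f (indicator S) * δ γ (replicate n 0)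
  coeff-∂^-indicator {n} {d} {f} hom S γ ≡.refl = begin
    coeff (scale 1# (∂^ (indicator S) f)) γ
      ≡⟨ cong (λ h → coeff (scale 1# h) γ) (∂^≡map (indicator S) f) ⟩
    coeff (scale 1# (List.map T f)) γ
      ≡⟨ cong (λ h → coeff h γ) (map-∘ f) ⟨
    coeff (List.map (λ t → 1# * proj₁ (T t) , proj₂ (T t)) f) γ
      ≈⟨ coeff-map (∘-linear scale-linear (∂^-term-linear (indicator S) (List.allFin n))) f γ ⟩
    weigh (λ α → 1# * proj₁ (T (1# , α)) * δ γ (proj₂ (T (1# , α)))) f
      -- Terms of f in other degrees have total coefficient 0, so comparing the weights in degree d
      -- is enough.
      ≈⟨ weigh-homogeneous f hom (λ α → ∂^-indicator-coeff S α γ) ⟩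
    weigh (λ α → δ (indicator S) α * δ γ (replicate n 0)) f
      ≈⟨ weigh-*ʳ (δ (indicator S)) _ f ⟩
    weigh (δ (indicator S)) f * δ γ (replicate n 0)
      ≈⟨ *-congʳ (coeff≈weigh f (indicator S)) ⟨
    coeff f (indicator S) * δ γ (replicate n 0) ∎
    where
    T : Term n → Term n
    T = ∂^-term (indicator S) (List.allFin n)

    scale-linear : CoefficientLinear {n} (λ (a , α) → (1# * a) , α)
    scale-linear a α =
      trans (*-identityˡ a) (sym (trans (*-congˡ (*-identityˡ 1#)) (*-identityʳ a))) , ≡.refl

  -- Each S of size d contributes its coefficient as a constant. Subsets of other sizes have
  -- coefficient 0 by homogeneity, so the sum may run over all subsets.
  elementary-⟨∂𝐱⟩ : ∀ {n d} {f : Polynomial n} → Homogeneous d f →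
    elementary n d ⟨∂𝐱⟩ f ≈ₚ constant (multilinearSum f)
  elementary-⟨∂𝐱⟩ {n} {d} {f} hom γ = begin
    coeff (elementary n d ⟨∂𝐱⟩ f) γ
      ≈⟨ coeff-⟨∂𝐱⟩ (elementary n d) f γ ⟩
    ∑ (λ (b , β) → coeff (scale b (∂^ β f)) γ) (elementary n d)
      ≈⟨ ∑-map (λ S → 1# , indicator S) (λ (b , β) → coeff (scale b (∂^ β f)) γ)
           (List.filter (λ S → size S ℕ.≟ d) (subsets n)) ⟩
    ∑ (λ S → coeff (scale 1# (∂^ (indicator S) f)) γ)
      (List.filter (λ S → size S ℕ.≟ d) (subsets n))
      ≈⟨ ∑-filter (λ S → size S ℕ.≟ d) (λ S → coeff-∂^-indicator hom S γ) off-degree (subsets n) ⟩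
    ∑ (λ S → coeff f (indicator S) * δ γ (replicate n 0)) (subsets n)
      ≈⟨ ∑-* (λ S → coeff f (indicator S)) _ (subsets n) ⟨
    multilinearSum f * δ γ (replicate n 0)
      ≈⟨ coeff-constant (multilinearSum f) γ ⟨
    coeff (constant (multilinearSum f)) γ ∎
    where
    off-degree : ∀ S → size S ≢ d → coeff f (indicator S) * δ γ (replicate n 0) ≈ 0#
    off-degree S ∣S∣≢d = trans
      (*-congʳ (hom (indicator S) (λ eq → ∣S∣≢d (≡.trans (≡.sym (sum-indicator S)) eq))))
      (zeroˡ _)

-- Weights on sign vectors, over a ring in which positive integers are invertible.

InvertsPositives : ∀ {c ℓ} (R : CommutativeRing c ℓ) → (ℕ → CommutativeRing.Carrier R) → Set ℓ
InvertsPositives R inv = ∀ m → inv m * (suc m · 1#) ≈ 1#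
  where
  open CommutativeRing R
  open RawSemiringDefinitions (Semiring.rawSemiring semiring) using () renaming (_×_ to _·_)

module Weights {c ℓ} (R : CommutativeRing c ℓ)
  (inv : ℕ → CommutativeRing.Carrier R) (inv-inverse : InvertsPositives R inv) where

  open CommutativeRing R hiding (zero)
  open Polynomials R
  open RawSemiringDefinitions (Semiring.rawSemiring semiring)
    using (_^_; product) renaming (_×_ to _·_)
  open SemiringMultProperties semiring using (×-homo-+)
  open SemiringExpProperties semiring using (^-congˡ)
  open SemiringSolver commutativeSemiring using (solve; _:=_; _:+_; _:*_; con)
  open RingProperties ring using (-1*x≈-x; -‿involutive)
  open ListSums R
  open LinearFunctionals R
  open Multilinear R
  open import Algebra.Properties.Monoid.Sum *-monoid using () renaming (sum-cong-≋ to product-cong)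
  open import Relation.Binary.Reasoning.Setoid setoid

  -- The semiring solver has no negation, so -1 is a named element that it treats as a variable;
  -- `1+ε` and `ε*ε` are applied by hand. `inv m` inverts m + 1, hence the index 1 for one half.
  ε ½ : Carrier
  ε = - 1#
  ½ = inv 1

  1+ε : 1# + ε ≈ 0#
  1+ε = -‿inverseʳ 1#

  ε*ε : ε * ε ≈ 1#
  ε*ε = trans (-1*x≈-x ε) (-‿involutive 1#)

  -- The solutions A, B of A + B = p m and A - B = p (m + 1). `semidiff` is minus half the forward
  -- difference.
  mean semidiff : (ℕ → Carrier) → ℕ → Carrier
  mean     p m = ½ * (p m + p (suc m))
  semidiff p m = ½ * (p m + ε * p (suc m))

  -- p is a polynomial function of degree less than k.
  DegreeBelow : ℕ → (ℕ → Carrier) → Set ℓ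
  DegreeBelow zero    p = ∀ m → p m ≈ 0#
  DegreeBelow (suc k) p = DegreeBelow k (semidiff p)

  degree-cong : ∀ k {p q} → (∀ m → p m ≈ q m) → DegreeBelow k p → DegreeBelow k q
  degree-cong zero    p≈q p≈0 m = trans (sym (p≈q m)) (p≈0 m)
  degree-cong (suc k) p≈q       = degree-cong k
    (λ m → *-congˡ (+-cong (p≈q m) (*-congˡ (p≈q (suc m)))))

  degree-+ : ∀ k {p q} → DegreeBelow k p → DegreeBelow k q → DegreeBelow k (λ m → p m + q m)
  degree-+ zero            p≈0 q≈0 m = trans (+-cong (p≈0 m) (q≈0 m)) (+-identityˡ 0#)
  degree-+ (suc k) {p} {q} dp  dq    = degree-cong k
    (λ m → solve 6 (λ h e a a′ b b′ →
      h :* (a :+ e :* a′) :+ h :* (b :+ e :* b′) := h :* ((a :+ b) :+ e :* (a′ :+ b′))) refl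
      ½ ε (p m) (p (suc m)) (q m) (q (suc m)))
    (degree-+ k dp dq)

  degree-* : ∀ k b {p} → DegreeBelow k p → DegreeBelow k (λ m → b * p m)
  degree-* zero    b     p≈0 m = trans (*-congˡ (p≈0 m)) (zeroʳ b)
  degree-* (suc k) b {p} dp    = degree-cong k
    (λ m → solve 5 (λ h e b a a′ → b :* (h :* (a :+ e :* a′)) := h :* (b :* a :+ e :* (b :* a′)))
      refl ½ ε b (p m) (p (suc m)))
    (degree-* k b dp)

  -- `mean` commutes with `semidiff`.
  degree-mean : ∀ k {p} → DegreeBelow k p → DegreeBelow k (mean p)
  degree-mean zero        p≈0 m = trans
    (*-congˡ (trans (+-cong (p≈0 m) (p≈0 (suc m))) (+-identityˡ 0#))) (zeroʳ ½)
  degree-mean (suc k) {p} dp    = degree-cong k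
    (λ m → solve 5 (λ h e a b c → h :* (h :* (a :+ e :* b) :+ h :* (b :+ e :* c)) :=
        h :* (h :* (a :+ b) :+ e :* (h :* (b :+ c)))) refl
      ½ ε (p m) (p (suc m)) (p (suc (suc m))))
    (degree-mean k dp)

  ½+½ : ½ + ½ ≈ 1#
  ½+½ = trans (solve 1 (λ h → h :+ h := h :* (con 1 :+ (con 1 :+ con 0))) refl ½) (inv-inverse 1)

  mean+semidiff : ∀ p m → mean p m + semidiff p m ≈ p m
  mean+semidiff p m = begin
    ½ * (a + b) + ½ * (a + ε * b)
      ≈⟨ solve 4 (λ h e a b → h :* (a :+ b) :+ h :* (a :+ e :* b) :=
           (h :+ h) :* a :+ h :* ((con 1 :+ e) :* b)) refl ½ ε a b ⟩
    (½ + ½) * a + ½ * ((1# + ε) * b)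
      ≈⟨ +-cong (*-congʳ ½+½) (*-congˡ (*-congʳ 1+ε)) ⟩
    1# * a + ½ * (0# * b)
      ≈⟨ solve 3 (λ h a b → con 1 :* a :+ h :* (con 0 :* b) := a) refl ½ a b ⟩
    a ∎
    where a = p m ; b = p (suc m)

  mean-semidiff : ∀ p m → mean p m + ε * semidiff p m ≈ p (suc m)
  mean-semidiff p m = begin
    ½ * (a + b) + ε * (½ * (a + ε * b))
      ≈⟨ solve 4 (λ h e a b → h :* (a :+ b) :+ e :* (h :* (a :+ e :* b)) :=
           h :* ((con 1 :+ e) :* a) :+ h :* (b :+ (e :* e) :* b)) refl ½ ε a b ⟩
    ½ * ((1# + ε) * a) + ½ * (b + (ε * ε) * b)
      ≈⟨ +-cong (*-congˡ (*-congʳ 1+ε)) (*-congˡ (+-congˡ (*-congʳ ε*ε))) ⟩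
    ½ * (0# * a) + ½ * (b + 1# * b)
      ≈⟨ solve 3 (λ h a b → h :* (con 0 :* a) :+ h :* (b :+ con 1 :* b) := (h :+ h) :* b)
             refl ½ a b ⟩
    (½ + ½) * b
      ≈⟨ trans (*-congʳ ½+½) (*-identityˡ b) ⟩
    b ∎
    where a = p m ; b = p (suc m)

  -- Leibniz rule for differences: semidiff (l p) = (l + b/2) semidiff p - (b/2) mean p. The shifted
  -- factor l + b/2 again has step b, so induction on k applies to the first product.
  degree-linear-* : ∀ k {p l : ℕ → Carrier} b → (∀ m → l (suc m) ≈ l m + b) →
    DegreeBelow k p → DegreeBelow (suc k) (λ m → l m * p m)
  degree-linear-* zero {p} {l} b _ p≈0 m = begin
    ½ * (l m * p m + ε * (l (suc m) * p (suc m)))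
      ≈⟨ *-congˡ (+-cong (*-congˡ (p≈0 m)) (*-congˡ (*-congˡ (p≈0 (suc m))))) ⟩
    ½ * (l m * 0# + ε * (l (suc m) * 0#))
      ≈⟨ solve 4 (λ h e x y → h :* (x :* con 0 :+ e :* (y :* con 0)) := con 0) refl
             ½ ε (l m) (l (suc m)) ⟩
    0# ∎
  degree-linear-* (suc k) {p} {l} b step dp = degree-cong (suc k) product-rule
    (degree-+ (suc k)
      (degree-linear-* k b (λ m → trans (+-congʳ (step m))
        (solve 3 (λ x b c → (x :+ b) :+ c := (x :+ c) :+ b) refl (l m) b (½ * b))) dp)
      (degree-* (suc k) (ε * (½ * b)) (degree-mean (suc k) dp)))
    where
    product-rule : ∀ m → (l m + ½ * b) * semidiff p m + ε * (½ * b) * mean p m ≈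
      semidiff (λ m → l m * p m) m
    product-rule m = begin
      (x + ½ * b) * s + ε * (½ * b) * t
        -- Inserting `ε * ε` lets the multiple of s be regrouped with t into `t + ε * s`, which is p
        -- (m + 1).
        ≈⟨ +-congʳ (*-congˡ (trans (sym (*-identityˡ s)) (*-congʳ (sym ε*ε)))) ⟩
      (x + ½ * b) * ((ε * ε) * s) + ε * (½ * b) * t
        ≈⟨ solve 6 (λ h e x b s t → (x :+ h :* b) :* ((e :* e) :* s) :+ e :* (h :* b) :* t :=
             x :* ((e :* e) :* s) :+ e :* (h :* b) :* (t :+ e :* s)) refl ½ ε x b s t ⟩
      x * ((ε * ε) * s) + ε * (½ * b) * (t + ε * s)
        ≈⟨ +-cong (*-congˡ (trans (*-congʳ ε*ε) (*-identityˡ s))) (*-congˡ (mean-semidiff p m)) ⟩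
      x * (½ * (p m + ε * p (suc m))) + ε * (½ * b) * p (suc m)
        ≈⟨ solve 6 (λ h e x b u v → x :* (h :* (u :+ e :* v)) :+ e :* (h :* b) :* v :=
             h :* (x :* u :+ e :* ((x :+ b) :* v))) refl ½ ε x b (p m) (p (suc m)) ⟩
      ½ * (x * p m + ε * ((x + b) * p (suc m)))
        ≈⟨ *-congˡ (+-congˡ (*-congˡ (*-congʳ (step m)))) ⟨
      ½ * (x * p m + ε * (l (suc m) * p (suc m))) ∎
      where x = l m ; s = semidiff p m ; t = mean p m

  -- A weight w for each queried point, whose coordinates are -1 on S and 1
  -- elsewhere.
  Rule : ℕ → Set c
  Rule n = List (Carrier × Subset n)

  prepend : ∀ {n} → Bool → Rule n → Rule (suc n)
  prepend s = List.map (λ (w , S) → w , s ∷ S)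

  -- The recursion is forced by apply-rule: adding an even exponent must keep
  -- the value p m and adding an odd one must change it to p (suc m), so the
  -- two halves must have sum p and difference p ∘ suc.
  rule : ∀ n → ℕ → (ℕ → Carrier) → Rule n
  rule zero    k       p = (p 0 , []) ∷ []
  rule (suc n) zero    p = prepend outside (rule n zero (mean p))
  rule (suc n) (suc k) p =
    prepend outside (rule n (suc k) (mean p)) ++ prepend inside (rule n k (semidiff p))

  sign : Bool → Carrier
  sign s = if s then ε else 1#

  point : ∀ {n} → Subset n → Vector Carrier n
  point S i = sign (lookup S i)

  monomial : ∀ {n} → Vector Carrier n → Exponent n → Carrier
  monomial v α = product (λ i → v i ^ lookup α i)

  applyRule : ∀ {n} → Rule n → Exponent n → Carrier
  applyRule W α = ∑ (λ (w , S) → w * monomial (point S) α) W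

  1^ : ∀ a → 1# ^ a ≈ 1#
  1^ zero    = refl
  1^ (suc a) = trans (*-identityˡ _) (1^ a)

  ε^ : ∀ a → parity a ≡ 0 × ε ^ a ≈ 1# ⊎ parity a ≡ 1 × ε ^ a ≈ ε
  ε^ zero          = inj₁ (≡.refl , refl)
  ε^ (suc zero)    = inj₂ (≡.refl , *-identityʳ ε)
  ε^ (suc (suc a))
    with ε^ a | trans (sym (*-assoc ε ε (ε ^ a))) (trans (*-congʳ ε*ε) (*-identityˡ (ε ^ a)))
  ... | inj₁ (even , eq) | cancel = inj₁ (even , trans cancel eq)
  ... | inj₂ (odd , eq)  | cancel = inj₂ (odd , trans cancel eq)

  apply-prepend : ∀ {n} s (W : Rule n) a α →
    applyRule (prepend s W) (a ∷ α) ≈ sign s ^ a * applyRule W α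
  apply-prepend s W a α = begin
    applyRule (prepend s W) (a ∷ α)
      ≈⟨ ∑-map _ _ W ⟩
    ∑ (λ (w , S) → w * (sign s ^ a * monomial (point S) α)) W
      ≈⟨ ∑-cong (λ (w , S) → solve 3 (λ w x y → w :* (x :* y) := x :* (w :* y)) refl
           w (sign s ^ a) (monomial (point S) α)) W ⟩
    ∑ (λ (w , S) → sign s ^ a * (w * monomial (point S) α)) W
      ≈⟨ *-∑ (sign s ^ a) _ W ⟨
    sign s ^ a * applyRule W α ∎

  apply-outside : ∀ {n} (W : Rule n) a α → applyRule (prepend outside W) (a ∷ α) ≈ applyRule W α
  apply-outside W a α = trans (apply-prepend outside W a α)
    (trans (*-congʳ (1^ a)) (*-identityˡ (applyRule W α)))

  recombine : ∀ p a m → mean p m + ε ^ a * semidiff p m ≈ p (parity a ℕ.+ m)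
  recombine p a m with parity a | ε^ a
  ... | _ | inj₁ (≡.refl , eq) = trans (+-congˡ (trans (*-congʳ eq) (*-identityˡ _)))
    (mean+semidiff p m)
  ... | _ | inj₂ (≡.refl , eq) = trans (+-congˡ (*-congʳ eq)) (mean-semidiff p m)

  -- Splitting off the first exponent a multiplies the `inside` half by (-1)^a, and `recombine`
  -- turns the two halves into p at the updated number of odd exponents.
  apply-rule : ∀ n k {p} → DegreeBelow (suc k) p → ∀ (α : Exponent n) →
    applyRule (rule n k p) α ≈ p (oddCount α)
  apply-rule zero    k       {p} dp []      = trans (+-identityʳ _) (*-identityʳ (p 0))
  apply-rule (suc n) zero    {p} dp (a ∷ α) = begin
    applyRule (prepend outside (rule n 0 (mean p))) (a ∷ α)
      ≈⟨ apply-outside (rule n 0 (mean p)) a α ⟩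
    applyRule (rule n 0 (mean p)) α
      ≈⟨ apply-rule n 0 (degree-mean 1 {p} dp) α ⟩
    mean p m
      -- For budget 0, `dp` says that `semidiff p` vanishes, so the absent half can be added for
      -- free.
      ≈⟨ trans (+-congˡ (trans (*-congˡ (dp m)) (zeroʳ _))) (+-identityʳ _) ⟨
    mean p m + ε ^ a * semidiff p m
      ≈⟨ recombine p a m ⟩
    p (parity a ℕ.+ m) ∎
    where m = oddCount α
  apply-rule (suc n) (suc k) {p} dp (a ∷ α) = begin
    applyRule (rule (suc n) (suc k) p) (a ∷ α)
      ≈⟨ ∑-++ _ (prepend outside (rule n (suc k) (mean p))) _ ⟩
    applyRule (prepend outside (rule n (suc k) (mean p))) (a ∷ α) +
    applyRule (prepend inside (rule n k (semidiff p))) (a ∷ α)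
      ≈⟨ +-cong (apply-outside (rule n (suc k) (mean p)) a α)
                (apply-prepend inside (rule n k (semidiff p)) a α) ⟩
    applyRule (rule n (suc k) (mean p)) α + ε ^ a * applyRule (rule n k (semidiff p)) α
      ≈⟨ +-cong (apply-rule n (suc k) (degree-mean (suc (suc k)) {p} dp) α)
                (*-congˡ (apply-rule n k dp α)) ⟩
    mean p m + ε ^ a * semidiff p m
      ≈⟨ recombine p a m ⟩
    p (parity a ℕ.+ m) ∎
    where m = oddCount α

  -- ∏_{1 ≤ j ≤ k} (m + 2j − d) / 2j
  factor target : ℕ → ℕ → ℕ → Carrier
  factor d j m       = inv (j ℕ.+ suc j) * ((m ℕ.+ (suc j ℕ.+ suc j)) · 1# + ε * (d · 1#))
  target d zero    m = 1#
  target d (suc k) m = factor d k m * target d k m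

  x+ε*x : ∀ x → x + ε * x ≈ 0#
  x+ε*x x = trans (+-congˡ (-1*x≈-x x)) (-‿inverseʳ x)

  -- Indices start at 0: `factor d j` is the factor with number j + 1, its root is d - 2(j + 1), and
  -- `inv (j + suc j)` inverts 2(j + 1).
  factor-zero : ∀ {d m} j → m ℕ.+ (suc j ℕ.+ suc j) ≡ d → factor d j m ≈ 0#
  factor-zero j ≡.refl = trans (*-congˡ (x+ε*x _)) (zeroʳ _)

  -- With e = h + 1 positive, the factor with number e vanishes at m = d - 2e, and e at most k puts
  -- it in the product.
  target-zero : ∀ {d} k m h → m ℕ.+ (suc h ℕ.+ suc h) ≡ d → suc h ℕ.≤ k → target d k m ≈ 0#
  target-zero {d} (suc k) m h eq h<k with ℕ.m≤n⇒m<n∨m≡n h<k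
  ... | inj₁ (s≤s h<k′) = trans (*-congˡ (target-zero k m h eq h<k′)) (zeroʳ _)
  ... | inj₂ ≡.refl     = trans (*-congʳ (factor-zero k eq)) (zeroˡ (target d k m))

  target-degree : ∀ d k → DegreeBelow (suc k) (target d k)
  target-degree d zero    m = trans (*-congˡ (x+ε*x 1#)) (zeroʳ ½)
  target-degree d (suc k)   = degree-linear-* (suc k) {target d k} {factor d k} (inv (k ℕ.+ suc k))
    (λ m → solve 3 (λ i x y → i :* (con 1 :+ x :+ y) := i :* (x :+ y) :+ i) refl
      (inv (k ℕ.+ suc k)) ((m ℕ.+ (suc k ℕ.+ suc k)) · 1#) (ε * (d · 1#)))
    (target-degree d k)

  factor-one : ∀ d j → factor d j d ≈ 1#
  factor-one d j = begin
    i * ((d ℕ.+ j₂) · 1# + ε * (d · 1#))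
      ≈⟨ *-congˡ (+-congʳ (×-homo-+ 1# d j₂)) ⟩
    i * (d · 1# + j₂ · 1# + ε * (d · 1#))
      ≈⟨ solve 4 (λ i x y z → i :* (x :+ y :+ z) := i :* y :+ i :* (x :+ z)) refl
           i (d · 1#) (j₂ · 1#) (ε * (d · 1#)) ⟩
    i * (j₂ · 1#) + i * (d · 1# + ε * (d · 1#))
      ≈⟨ +-cong (inv-inverse (j ℕ.+ suc j)) (trans (*-congˡ (x+ε*x (d · 1#))) (zeroʳ i)) ⟩
    1# + 0#
      ≈⟨ +-identityʳ 1# ⟩
    1# ∎
    where
    i = inv (j ℕ.+ suc j)
    j₂ = suc j ℕ.+ suc j

  target-one : ∀ d k → target d k d ≈ 1#
  target-one d zero    = refl
  target-one d (suc k) = trans (*-cong (factor-one d k) (target-one d k)) (*-identityˡ 1#)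

  -- In degree d both sides are 1 if `halfSum α` is 0 and 0 otherwise. A positive `halfSum α` is at
  -- most half of d, which puts it among the roots covered by the product.
  target-multilinear : ∀ {n d} (α : Exponent n) → Vec.sum α ≡ d →
    target d ⌊ d /2⌋ (oddCount α) ≈ ∑ (λ S → δ (indicator S) α) (subsets n)
  target-multilinear {d = d} α ≡.refl = by-cases (halfSum α) ≡.refl
    where
    by-cases : ∀ h → halfSum α ≡ h →
      target d ⌊ d /2⌋ (oddCount α) ≈ ∑ (λ S → δ (indicator S) α) (subsets _)
    by-cases zero    eq = trans
      (trans (reflexive (cong (target d ⌊ d /2⌋) odd≡d)) (target-one d ⌊ d /2⌋))
      (sym (∑-δ-multilinear α eq))
      where
      odd≡d : oddCount α ≡ d
      odd≡d = ≡.trans (≡.sym (ℕ.+-identityʳ _))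
        (subst (λ h → oddCount α ℕ.+ (h ℕ.+ h) ≡ d) eq (oddCount+halfSum α))
    by-cases (suc h) eq = trans
      (target-zero ⌊ d /2⌋ (oddCount α) h
        (subst (λ h → oddCount α ℕ.+ (h ℕ.+ h) ≡ d) eq (oddCount+halfSum α))
        (subst (ℕ._≤ ⌊ d /2⌋) eq (halfSum≤⌊sum/2⌋ α)))
      (sym (∑-δ-nonmultilinear α (λ eq′ → ℕ.0≢1+n (≡.trans (≡.sym eq′) eq))))

  -- The query program.

  -- Registers `plus` and `minus` hold 1 and -1. Each round fills four registers (answer, weight,
  -- product, new total), so old numbers shift by four and the new total is register 0.
  weightedSum : ∀ {n k} → Rule n → (plus minus total : Fin k) → Program n k
  weightedSum []             plus minus total = output total
  weightedSum ((w , S) ∷ W) plus minus total =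
    query (λ i → if lookup S i then minus else plus)
      (literal w (mul zero (suc zero) (add zero (suc (suc (suc total)))
        (weightedSum W (suc (suc (suc (suc plus)))) (suc (suc (suc (suc minus)))) zero))))

  ruleProgram : ∀ {n} → Rule n → Program n 0
  ruleProgram W = literal 1# (neg zero (literal 0#
    (weightedSum W (suc (suc zero)) (suc zero) zero)))

  queries-weightedSum : ∀ {n k} (W : Rule n) (plus minus total : Fin k) →
    queries (weightedSum W plus minus total) ≡ length W
  queries-weightedSum []      plus minus total = ≡.refl
  queries-weightedSum (_ ∷ W) plus minus total = cong suc (queries-weightedSum W _ _ _)

  -- The queried point is read from registers that equal 1 and -1 only up to `_≈_`, so F has to
  -- respect this equality.
  exec-weightedSum : ∀ {n k} (W : Rule n) (plus minus total : Fin k) F r →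
    (∀ {u v} → (∀ i → u i ≈ v i) → F u ≈ F v) → r plus ≈ 1# → r minus ≈ ε →
    exec (weightedSum W plus minus total) F r ≈ r total + ∑ (λ (w , S) → w * F (point S)) W
  exec-weightedSum []             plus minus total F r F-cong r₊ r₋ = sym (+-identityʳ (r total))
  exec-weightedSum ((w , S) ∷ W) plus minus total F r F-cong r₊ r₋ = begin
    exec (weightedSum W _ _ zero) F _
      ≈⟨ exec-weightedSum W _ _ zero F _ F-cong r₊ r₋ ⟩
    w * F (λ i → r (if lookup S i then minus else plus)) + r total + rest
      ≈⟨ +-congʳ (+-congʳ (*-congˡ (F-cong at-point))) ⟩
    w * F (point S) + r total + rest
      ≈⟨ solve 3 (λ x y z → x :+ y :+ z := y :+ (x :+ z)) refl (w * F (point S)) (r total) rest ⟩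
    r total + (w * F (point S) + rest) ∎
    where
    rest = ∑ (λ (w , S) → w * F (point S)) W

    at-point : ∀ i → r (if lookup S i then minus else plus) ≈ point S i
    at-point i with lookup S i
    ... | true  = r₋
    ... | false = r₊

  eval≈weigh : ∀ {n} (f : Polynomial n) v → eval f v ≈ weigh (monomial v) f
  eval≈weigh []      v = refl
  eval≈weigh (_ ∷ f) v = +-congˡ (eval≈weigh f v)

  eval-cong : ∀ {n} (f : Polynomial n) {u v} → (∀ i → u i ≈ v i) → eval f u ≈ eval f v
  eval-cong f {u} {v} u≈v = trans (eval≈weigh f u)
    (trans (weigh-cong (λ α → product-cong (λ i → ^-congˡ (lookup α i) (u≈v i))) f)
      (sym (eval≈weigh f v)))

  run-ruleProgram : ∀ {n} (W : Rule n) f → run (ruleProgram W) (eval f) ≈ weigh (applyRule W) f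
  run-ruleProgram W f = begin
    run (ruleProgram W) (eval f)
      ≈⟨ exec-weightedSum W _ _ zero (eval f) _ (eval-cong f) refl refl ⟩
    0# + ∑ (λ (w , S) → w * eval f (point S)) W
      ≈⟨ +-identityˡ _ ⟩
    ∑ (λ (w , S) → w * eval f (point S)) W
      ≈⟨ ∑-cong (λ (w , S) → pull w (point S)) W ⟩
    ∑ (λ (w , S) → weigh (λ α → w * monomial (point S) α) f) W
      ≈⟨ ∑-weigh (λ (w , S) α → w * monomial (point S) α) W f ⟩
    weigh (applyRule W) f ∎
    where
    pull : ∀ w v → w * eval f v ≈ weigh (λ α → w * monomial v α) f
    pull w v = begin
      w * eval f v                            ≈⟨ *-congˡ (eval≈weigh f v) ⟩
      w * weigh (monomial v) f                ≈⟨ *-∑ w _ f ⟩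
      ∑ (λ (a , α) → w * (a * monomial v α)) f
        ≈⟨ ∑-cong (λ (a , α) → solve 3 (λ w a x → w :* (a :* x) := a :* (w :* x)) refl
             w a (monomial v α)) f ⟩
      weigh (λ α → w * monomial v α) f        ∎

  -- The recursion of `rule` is Pascal's recursion for partial row sums.
  length-rule : ∀ n k p → length (rule n k p) ≡ binomialSum n k
  length-rule zero    k       p = ≡.sym (binomialSum-zeroˡ k)
  length-rule (suc n) zero    p = ≡.trans (length-map _ (rule n 0 (mean p))) (length-rule n 0 (mean p))
  length-rule (suc n) (suc k) p = ≡.trans
    (length-++ (prepend outside (rule n (suc k) (mean p))))
    (≡.trans
      (cong₂ ℕ._+_
        (≡.trans (length-map _ (rule n (suc k) (mean p))) (length-rule n (suc k) (mean p)))
        (≡.trans (length-map _ (rule n k (semidiff p))) (length-rule n k (semidiff p))))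
      (binomialSum-pascal n k))

  multilinearProgram : ∀ n d → Program n 0
  multilinearProgram n d = ruleProgram (rule n ⌊ d /2⌋ (target d ⌊ d /2⌋))

  queries-multilinearProgram : ∀ n d → queries (multilinearProgram n d) ≡ binomialSum n ⌊ d /2⌋
  queries-multilinearProgram n d =
    ≡.trans (queries-weightedSum (rule n ⌊ d /2⌋ (target d ⌊ d /2⌋)) _ _ _)
      (length-rule n ⌊ d /2⌋ _)

  run-multilinearProgram : ∀ {n d} {f : Polynomial n} → Homogeneous d f →
    run (multilinearProgram n d) (eval f) ≈ multilinearSum f
  run-multilinearProgram {n} {d} {f} hom = begin
    run (multilinearProgram n d) (eval f)
      ≈⟨ run-ruleProgram (rule n ⌊ d /2⌋ (target d ⌊ d /2⌋)) f ⟩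
    weigh (applyRule (rule n ⌊ d /2⌋ (target d ⌊ d /2⌋))) f
      ≈⟨ weigh-cong (apply-rule n ⌊ d /2⌋ (target-degree d ⌊ d /2⌋)) f ⟩
    weigh (target d ⌊ d /2⌋ ∘ oddCount) f
      ≈⟨ weigh-homogeneous f hom (target-multilinear) ⟩
    weigh (λ α → ∑ (λ S → δ (indicator S) α) (subsets n)) f
      ≈⟨ multilinearSum≈weigh f ⟨
    multilinearSum f ∎

-- Specialisation to the complex numbers.

open import Defs

private
  module ℂR = CommutativeRing ℂ-commutativeRing

open RawSemiringDefinitions (Semiring.rawSemiring ℂR.semiring) using () renaming (_×_ to _·_)

embed : ℚ → ℂ
embed q = fromℚ q +i fromℚ 0ℚ

-- The recursion mirrors that of `_·_`, so `embed-ℕ` holds termwise by computation.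
ℕ⇒ℚ : ℕ → ℚ
ℕ⇒ℚ zero    = 0ℚ
ℕ⇒ℚ (suc m) = 1ℚ ℚ.+ ℕ⇒ℚ m

embed-ℕ : ∀ m → m · 1ℂ ≈ℂ embed (ℕ⇒ℚ m)
embed-ℕ zero    = ℂR.refl
embed-ℕ (suc m) = ℂR.trans (ℂR.+-congˡ {1ℂ} (embed-ℕ m))
  (mk≈ℂ (pointwise λ _ → ≡.refl) (pointwise λ _ → ≡.refl))

ℕ⇒ℚ-positive : ∀ m → 0ℚ ℚ.< ℕ⇒ℚ (suc m)
ℕ⇒ℚ-positive zero    = ℚ.positive⁻¹ (ℕ⇒ℚ 1)
ℕ⇒ℚ-positive (suc m) = ℚ.+-mono-< (ℚ.positive⁻¹ 1ℚ) (ℕ⇒ℚ-positive m)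

ℕ⇒ℚ-nonZero : ∀ m → ℚ.NonZero (ℕ⇒ℚ (suc m))
ℕ⇒ℚ-nonZero m = ℚ.pos⇒nonZero (ℕ⇒ℚ (suc m)) {{ℚ.positive (ℕ⇒ℚ-positive m)}}

inverse : ℕ → ℂ
inverse m = embed (ℚ.1/_ (ℕ⇒ℚ (suc m)) {{ℕ⇒ℚ-nonZero m}})

inverse-inverts : InvertsPositives ℂ-commutativeRing inverse
inverse-inverts m = ℂR.trans (ℂR.*-congˡ {inverse m} (embed-ℕ (suc m)))
  (mk≈ℂ
    -- The imaginary parts contribute `- (0ℚ * 0ℚ)` to the real part, which computes to `0ℚ`.
    (pointwise λ _ → cong (ℚ._+ 0ℚ) (ℚ.*-inverseˡ q {{ℕ⇒ℚ-nonZero m}}))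
    (pointwise λ _ → cong₂ ℚ._+_ (ℚ.*-zeroʳ (ℚ.1/_ q {{ℕ⇒ℚ-nonZero m}})) (ℚ.*-zeroˡ q)))
  where q = ℕ⇒ℚ (suc m)

open Multilinear ℂ-commutativeRing using (elementary-⟨∂𝐱⟩; coeff-constant)
open Weights ℂ-commutativeRing inverse inverse-inverts
  using (multilinearProgram; queries-multilinearProgram; run-multilinearProgram)

constant-cong : ∀ {n x y} → x ≈ℂ y → constant {n} x ≈ₚ constant y
constant-cong {x = x} {y} x≈y α =
  ℂR.trans (coeff-constant x α) (ℂR.trans (ℂR.*-congʳ x≈y) (ℂR.sym (coeff-constant y α)))

mainTheorem5 : (n d : ℕ) →
    Σ[ p ∈ Program n 0 ]
    (queries p ≡ binomialSum n ⌊ d /2⌋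
    × ((f : Polynomial n) → Homogeneous d f →
    (elementary n d ⟨∂𝐱⟩ f ≈ₚ constant (run p (eval f)))
    × (run p (eval f) ≈ℂ multilinearSum f)))
mainTheorem5 n d = multilinearProgram n d , queries-multilinearProgram n d , λ f hom →
  let run≈ = run-multilinearProgram {f = f} hom
  in (λ α → ℂR.trans (elementary-⟨∂𝐱⟩ {f = f} hom α)
       (constant-cong {n} (ℂR.sym run≈) α))
     , run≈
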